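{- Let $0\le k\le n$ and let $\alpha\in\mathscr{D}_k^3$ be a $3$-colored derangement of length $k$. Then \[\sum_{\sigma\in S_n^3,\ dp(\sigma)=\alpha} q^{\mathrm{fmaj}_3(\sigma)} = q^{\mathrm{fmaj}_3(\alpha)}{n\brack k}_{q^3},\] where ${n\brack k}_{q^3}$ is the Gaussian binomial coefficient in the variable $q^3$, i.e. ${n\brack k}_{t}=\frac{(1-t)(1-t^2)\cdots(1-t^n)}{(1-t)\cdots(1-t^k)\,(1-t)\cdots(1-t^{n-k})}$ with $t=q^3$.
   Context: A $3$-colored permutation in $S_n^3$ is a word $\sigma(1)\sigma(2)\cdots\sigma(n)$ of colored letters $\sigma(i)=a_{c}$, where the underlying letters form a permutation of $[n]=\{1,\dots,n\}$ and each color (subscript) $c\in\{0,1,2\}$. Colored letters are totally ordered by $1_2<2_2<\cdots<n_2<1_1<2_1<\cdots<n_1<1_0<2_0<\cdots<n_0$. The descent set is $D(\sigma)=\{i\in[n-1]:\sigma(i)>\sigma(i+1)\}$ (with respect to this order), $\mathrm{maj}(\sigma)=\sum_{i\in D(\sigma)}i$, $N_j(\sigma)$ is the number of letters of $\sigma$ with color $j$, and $\mathrm{fmaj}_3(\sigma)=3\,\mathrm{maj}(\sigma)+N_1(\sigma)+2N_2(\sigma)$. A position $i$ is a fixed point of $\sigma$ if $\sigma(i)=i_0$ (the letter $i$ with color $0$). The set of derangements is $\mathscr{D}_k^3=\{\sigma\in S_k^3:\sigma(i)\ne i_0\text{ for all }i\in[k]\}$ (for $k=0$ it consists of the empty word,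 with $\mathrm{fmaj}_3=0$). The reduction of a word of colored letters whose underlying letters are distinct elements $a_1<a_2<\cdots<a_m$ of the positive integers replaces each $a_i$ by $i$ while keeping its color. The derangement part $dp(\sigma)$ of $\sigma\in S_n^3$ is the reduction of the word obtained from $\sigma$ by deleting all letters at fixed points; e.g. $dp(8_0 1_2 5_1 4_0 3_1 6_0 7_1 2_2)=6_0 1_2 4_1 3_1 5_1 2_2$. -}

module Defs where

open import Data.Nat using (ℕ; zero; suc; _+_; _*_; _∸_; _≤_; _≤?_; _<ᵇ_; _≡ᵇ_)
import Data.Nat.Properties as ℕP
open import Data.Fin using (Fin; toℕ)
import Data.Fin.Properties as FinP
open import Data.Bool using (Bool; true; false; _∨_; _∧_; if_then_else_)
open import Data.Product using (_×_; _,_; proj₁; proj₂)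
import Data.Product.Properties as ProdP
open import Data.List using (List; []; _∷_; length; map; filter; concatMap; lookup; upTo)
import Data.List.Properties as ListP
open import Data.List.Relation.Unary.All using (All; all?)
open import Data.List.Relation.Unary.Unique.Propositional using (Unique)
open import Data.List.Relation.Unary.Unique.DecPropositional ℕP._≟_ using (unique?)
open import Data.Integer using (ℤ; 0ℤ; 1ℤ) renaming (_+_ to _+ℤ_; _*_ to _*ℤ_; -_ to -ℤ_)
open import Relation.Nullary using (Dec; yes; no; ¬_)
open import Relation.Nullary.Decidable using (_×-dec_)
open import Relation.Binary.PropositionalEquality using (_≡_)
open import Relation.Binary.Definitions using (DecidableEquality)

CLetter : Set
CLetter = ℕ × Fin 3

-- A word of colored letters, σ(1)σ(2)⋯σ(n) (list head = σ(1)).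
Word : Set
Word = List CLetter

_≟ᶜ_ : DecidableEquality CLetter
_≟ᶜ_ = ProdP.≡-dec ℕP._≟_ FinP._≟_

_≟ʷ_ : DecidableEquality Word
_≟ʷ_ = ListP.≡-dec _≟ᶜ_

-- The total order  1_2 < ⋯ < n_2 < 1_1 < ⋯ < n_1 < 1_0 < ⋯ < n_0 :
-- a_c < b_d  iff  d < c, or (c = d and a < b).
_<ᶜ_ : CLetter → CLetter → Bool
(a , c) <ᶜ (b , d) = (toℕ d <ᵇ toℕ c) ∨ ((toℕ c ≡ᵇ toℕ d) ∧ (a <ᵇ b))

majFrom : ℕ → Word → ℕ
majFrom i (x ∷ y ∷ r) = (if y <ᶜ x then i else 0) + majFrom (suc i) (y ∷ r)
majFrom i _           = 0

maj : Word → ℕ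
maj = majFrom 1

N : ℕ → Word → ℕ
N j w = length (filter (λ x → toℕ (proj₂ x) ℕP.≟ j) w)

fmaj₃ : Word → ℕ
fmaj₃ w = 3 * maj w + N 1 w + 2 * N 2 w

-- σ ∈ S_n^3 : σ has length n and its underlying letters are distinct
-- elements of [n] = {1,…,n} (i.e. they form a permutation of [n]);
-- colors are arbitrary in {0,1,2}.
InRange : ℕ → CLetter → Set
InRange n x = (1 ≤ proj₁ x) × (proj₁ x ≤ n)

IsColPerm : ℕ → Word → Set
IsColPerm n w = (length w ≡ n) × (All (InRange n) w × Unique (map proj₁ w))

isColPerm? : (n : ℕ) → (w : Word) → Dec (IsColPerm n w)
isColPerm? n w =
  (length w ℕP.≟ n) ×-dec
  (all? (λ x → (1 ≤? proj₁ x) ×-dec (proj₁ x ≤? n)) w ×-dec unique? (map proj₁ w))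

words : ℕ → List CLetter → List Word
words zero    A = [] ∷ []
words (suc m) A = concatMap (λ x → map (x ∷_) (words m A)) A

alphabet : ℕ → List CLetter
alphabet n = concatMap (λ a → map (λ c → (suc a , c)) (Data.List.allFin 3)) (upTo n)

-- An explicit duplicate-free enumeration of S_n^3.
S³ : ℕ → List Word
S³ n = filter (isColPerm? n) (words n (alphabet n))

FixedPointFree : Word → Set
FixedPointFree w = (i : Fin (length w)) → ¬ (lookup w i ≡ (suc (toℕ i) , Fin.zero))
  where import Data.Fin as Fin

IsDerangement : ℕ → Word → Set
IsDerangement k α = IsColPerm k α × FixedPointFree α

-- Delete the letters at fixed points; i is the (1-based) position of the head.
delFixed : ℕ → Word → Word
delFixed i []      = []
delFixed i (x ∷ r) with x ≟ᶜ (i , Data.Fin.zero)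
... | yes _ = delFixed (suc i) r
... | no  _ = x ∷ delFixed (suc i) r

reduce : Word → Word
reduce w = map (λ x → (rank (proj₁ x) , proj₂ x)) w
  where
  rank : ℕ → ℕ
  rank a = length (filter (λ b → b ≤? a) (map proj₁ w))

dp : Word → Word
dp σ = reduce (delFixed 1 σ)

Poly : Set
Poly = ℕ → ℤ

sumℤ : List ℤ → ℤ
sumℤ []      = 0ℤ
sumℤ (x ∷ r) = x +ℤ sumℤ r

mono : ℕ → Poly
mono e m with e ℕP.≟ m
... | yes _ = 1ℤ
... | no  _ = 0ℤ

oneP : Poly
oneP = mono 0

_-P_ : Poly → Poly → Poly
(f -P g) m = f m +ℤ (-ℤ g m)

_*P_ : Poly → Poly → Poly
(f *P g) m = sumℤ (map (λ i → f i *ℤ g (m ∸ i)) (upTo (suc m)))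

genFun : List Word → (Word → ℕ) → Poly
genFun ws stat m = sumℤ (map (λ w → mono (stat w) m) ws)

qfact₃ : ℕ → Poly
qfact₃ zero    = oneP
qfact₃ (suc n) = qfact₃ n *P (oneP -P mono (3 * suc n))

LHS : ℕ → Word → Poly
LHS n α = genFun (filter (λ σ → dp σ ≟ʷ α) (S³ n)) fmaj₃

module Submission where

-- A coloured permutation σ with dp σ = α is determined by its fixed-point pattern, a word of k letters
-- of α and n − k fixed points, and every pattern occurs. Filling a pattern keeps N₁ and N₂, and its
-- maj depends only on the pattern, α's descents, and which letters of α lie above a neighbouring
-- fixed point. Growing patterns at their last entry, these maj values satisfy the two q-Pascal
-- recurrences, so they are maj α plus the exponents of [n k]_q; and
-- (t;t)_k (t;t)_{n−k} [n k]_t = (t;t)_n by the same recurrence.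

open import Defs
open import Data.Nat using (ℕ; suc; _≤_; _∸_)
open import Relation.Binary.PropositionalEquality using (_≡_; refl)
open import Data.Bool using (Bool; true; false)

cong₃ : ∀ {A B C D : Set} (f : A → B → C → D) {a a′ b b′ c c′} → a ≡ a′ → b ≡ b′ → c ≡ c′ → f a b c ≡ f a′ b′ c′
cong₃ f refl refl refl = refl

module Polynomial where

  open import Data.Nat using (zero; suc) renaming (_+_ to _+ℕ_)
  import Data.Nat.Properties as ℕ
  open import Data.Integer using (ℤ; 0ℤ; 1ℤ; _+_; _*_; -_)
  import Data.Integer.Properties as ℤ
  open import Data.Integer.Tactic.RingSolver using (solve-∀)
  open import Data.List using (List; []; _∷_; map; applyUpTo; _++_)
  import Data.List.Properties as List
  open import Data.List.Relation.Binary.Permutation.Propositional as ↭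
    using (_↭_)
  open import Algebra.Bundles using (CommutativeMonoid)
  open import Relation.Binary.Bundles using (Setoid)
  import Relation.Binary.Reasoning.Setoid as SetoidReasoning
  open import Relation.Binary.PropositionalEquality
  open import Relation.Nullary using (yes; no; ¬_)
  open import Data.Empty using (⊥-elim)
  open import Function using (_∘_)

  infix  4 _≈_
  infixl 6 _+P_
  infixl 7 _·_

  _≈_ : Poly → Poly → Set
  f ≈ g = ∀ m → f m ≡ g m

  ≈-setoid : Setoid _ _
  ≈-setoid = record
    { Carrier       = Poly
    ; _≈_           = _≈_
    ; isEquivalence = record
      { refl  = λ _ → refl
      ; sym   = λ p m → sym (p m)
      ; trans = λ p q m → trans (p m) (q m)
      }
    }

  open Setoid ≈-setoid public using () renaming (refl to ≈-refl; sym to ≈-sym; trans to ≈-trans)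
  module ≈-Reasoning = SetoidReasoning ≈-setoid

  _+P_ : Poly → Poly → Poly
  (f +P g) m = f m + g m

  +P-cong : ∀ {f f′ g g′} → f ≈ f′ → g ≈ g′ → f +P g ≈ f′ +P g′
  +P-cong ef eg m = cong₂ _+_ (ef m) (eg m)

  _·_ : Poly → Poly → Poly
  (f · g) zero    = f 0 * g 0
  (f · g) (suc m) = f 0 * g (suc m) + ((f ∘ suc) · g) m

  map-applyUpTo : ∀ {A B : Set} (h : A → B) (f : ℕ → A) n →
                  map h (applyUpTo f n) ≡ applyUpTo (h ∘ f) n
  map-applyUpTo h f zero    = refl
  map-applyUpTo h f (suc n) = cong (h (f 0) ∷_) (map-applyUpTo h (f ∘ suc) n)

  sumℤ-convolution : ∀ f g m → sumℤ (applyUpTo (λ i → f i * g (m ∸ i)) (suc m)) ≡ (f · g) m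
  sumℤ-convolution f g zero    = ℤ.+-identityʳ _
  sumℤ-convolution f g (suc m) = cong (f 0 * g (suc m) +_) (sumℤ-convolution (f ∘ suc) g m)

  *P≈· : ∀ f g → f *P g ≈ f · g
  *P≈· f g m = trans (cong sumℤ (map-applyUpTo (λ i → f i * g (m ∸ i)) (λ i → i) (suc m))) (sumℤ-convolution f g m)

  ·-cong : ∀ {f f′ g g′} → f ≈ f′ → g ≈ g′ → f · g ≈ f′ · g′
  ·-cong ef eg zero    = cong₂ _*_ (ef 0) (eg 0)
  ·-cong ef eg (suc m) = cong₂ _+_ (cong₂ _*_ (ef 0) (eg (suc m))) (·-cong (ef ∘ suc) eg m)

  ·-suc : ∀ f g m → (f · g) (suc m) ≡ (f · (g ∘ suc)) m + f (suc m) * g 0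
  ·-suc f g zero    = refl
  ·-suc f g (suc m) = trans (cong (f 0 * g (suc (suc m)) +_) (·-suc (f ∘ suc) g m))
                            (sym (ℤ.+-assoc (f 0 * g (suc (suc m))) (((f ∘ suc) · (g ∘ suc)) m) _))

  ·-comm : ∀ f g → f · g ≈ g · f
  ·-comm f g zero    = ℤ.*-comm (f 0) (g 0)
  ·-comm f g (suc m) = begin
    f 0 * g (suc m) + ((f ∘ suc) · g) m ≡⟨ cong₂ _+_ (ℤ.*-comm (f 0) _) (·-comm (f ∘ suc) g m) ⟩
    g (suc m) * f 0 + (g · (f ∘ suc)) m ≡⟨ ℤ.+-comm (g (suc m) * f 0) _ ⟩
    (g · (f ∘ suc)) m + g (suc m) * f 0 ≡⟨ sym (·-suc g f m) ⟩
    (g · f) (suc m)                     ∎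
    where open ≡-Reasoning

  ·-distribˡ-+ : ∀ f g h → f · (g +P h) ≈ f · g +P f · h
  ·-distribˡ-+ f g h zero    = ℤ.*-distribˡ-+ (f 0) (g 0) (h 0)
  ·-distribˡ-+ f g h (suc m) =
    trans (cong₂ _+_ (ℤ.*-distribˡ-+ (f 0) (g (suc m)) (h (suc m))) (·-distribˡ-+ (f ∘ suc) g h m))
          (interchange (f 0 * g (suc m)) (f 0 * h (suc m)) _ _)
    where
    interchange : ∀ a b c d → a + b + (c + d) ≡ a + c + (b + d)
    interchange = solve-∀

  ·-distribʳ-+ : ∀ f g h → (f +P g) · h ≈ f · h +P g · h
  ·-distribʳ-+ f g h m =
    trans (·-comm (f +P g) h m)
          (trans (·-distribˡ-+ h f g m) (cong₂ _+_ (·-comm h f m) (·-comm h g m)))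

  ·-distribˡ-∸ : ∀ f g h → f · (g -P h) ≈ (f · g) -P (f · h)
  ·-distribˡ-∸ f g h zero    = distrib (f 0) (g 0) (h 0)
    where
    distrib : ∀ a b c → a * (b + - c) ≡ a * b + - (a * c)
    distrib = solve-∀
  ·-distribˡ-∸ f g h (suc m) = trans (cong (f 0 * (g -P h) (suc m) +_) (·-distribˡ-∸ (f ∘ suc) g h m))
                                      (distrib (f 0) (g (suc m)) (h (suc m)) _ _)
    where
    distrib : ∀ a b c d e → a * (b + - c) + (d + - e) ≡ a * b + d + - (a * c + e)
    distrib = solve-∀

  ·-assoc : ∀ f g h → (f · g) · h ≈ f · (g · h)
  ·-assoc f g h zero    = ℤ.*-assoc (f 0) (g 0) (h 0)
  ·-assoc f g h (suc m) = begin
    f 0 * g 0 * h (suc m) + (((f · g) ∘ suc) · h) m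
      ≡⟨ cong (f 0 * g 0 * h (suc m) +_) tail-product ⟩
    f 0 * g 0 * h (suc m) + (f 0 * ((g ∘ suc) · h) m + ((f ∘ suc) · (g · h)) m)
      ≡⟨ regroup (f 0) (g 0) (h (suc m)) _ _ ⟩
    f 0 * (g 0 * h (suc m) + ((g ∘ suc) · h) m) + ((f ∘ suc) · (g · h)) m
      ∎
    where
    open ≡-Reasoning
    scale : ℤ → Poly → Poly
    scale c f m = c * f m
    ·-scaleˡ : ∀ c f g → scale c f · g ≈ scale c (f · g)
    ·-scaleˡ c f g zero    = ℤ.*-assoc c (f 0) (g 0)
    ·-scaleˡ c f g (suc m) =
      trans (cong₂ _+_ (ℤ.*-assoc c (f 0) (g (suc m))) (·-scaleˡ c (f ∘ suc) g m))
            (sym (ℤ.*-distribˡ-+ c _ _))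
    tail-product : (((f · g) ∘ suc) · h) m ≡ f 0 * ((g ∘ suc) · h) m + ((f ∘ suc) · (g · h)) m
    tail-product = trans (·-distribʳ-+ (scale (f 0) (g ∘ suc)) ((f ∘ suc) · g) h m)
                         (cong₂ _+_ (·-scaleˡ (f 0) (g ∘ suc) h m) (·-assoc (f ∘ suc) g h m))
    regroup : ∀ a b c d e → a * b * c + (a * d + e) ≡ a * (b * c + d) + e
    regroup = solve-∀

  mono-≡ : ∀ e → mono e e ≡ 1ℤ
  mono-≡ e with e ℕ.≟ e
  ... | yes _ = refl
  ... | no e≢e = ⊥-elim (e≢e refl)

  mono-≢ : ∀ {e m} → ¬ e ≡ m → mono e m ≡ 0ℤ
  mono-≢ {e} {m} e≢m with e ℕ.≟ m
  ... | yes e≡m = ⊥-elim (e≢m e≡m)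
  ... | no _    = refl

  mono-suc : ∀ e m → mono (suc e) (suc m) ≡ mono e m
  mono-suc e m with e ℕ.≟ m
  ... | yes refl = mono-≡ (suc e)
  ... | no e≢m   = mono-≢ (e≢m ∘ ℕ.suc-injective)

  ·-identityˡ : ∀ f → oneP · f ≈ f
  ·-identityˡ f zero    = ℤ.*-identityˡ (f 0)
  ·-identityˡ f (suc m) = trans (cong₂ _+_ (ℤ.*-identityˡ (f (suc m))) (no-tail (mono 0 ∘ suc) (λ m → mono-≢ {0} {suc m} (λ ())) m))
                                (ℤ.+-identityʳ _)
    where
    no-tail : ∀ g → g ≈ (λ _ → 0ℤ) → g · f ≈ (λ _ → 0ℤ)
    no-tail g g≈0 zero    = trans (cong (_* f 0) (g≈0 0)) (ℤ.*-zeroˡ (f 0))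
    no-tail g g≈0 (suc m) = trans (cong₂ _+_ (trans (cong (_* f (suc m)) (g≈0 0)) (ℤ.*-zeroˡ (f (suc m))))
                                             (no-tail (g ∘ suc) (g≈0 ∘ suc) m))
                                  (ℤ.+-identityˡ 0ℤ)

  ·-identityʳ : ∀ f → f · oneP ≈ f
  ·-identityʳ f = ≈-trans (·-comm f oneP) (·-identityˡ f)

  ·-commutativeMonoid : CommutativeMonoid _ _
  ·-commutativeMonoid = record
    { Carrier = Poly
    ; _≈_     = _≈_
    ; _∙_     = _·_
    ; ε       = oneP
    ; isCommutativeMonoid = record
      { isMonoid = record
        { isSemigroup = record
          { isMagma = record
            { isEquivalence = Setoid.isEquivalence ≈-setoid
            ; ∙-cong        = ·-cong
            }
          ; assoc = ·-assoc
          }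
        ; identity = ·-identityˡ , ·-identityʳ
        }
      ; comm = ·-comm
      }
    }
    where open import Data.Product using (_,_)

  mono-suc-·-zero : ∀ e f → (mono (suc e) · f) 0 ≡ 0ℤ
  mono-suc-·-zero e f = trans (cong (_* f 0) (mono-≢ {suc e} {0} (λ ()))) (ℤ.*-zeroˡ (f 0))

  mono-suc-·-suc : ∀ e f m → (mono (suc e) · f) (suc m) ≡ (mono e · f) m
  mono-suc-·-suc e f m =
    trans (cong₂ _+_ (trans (cong (_* f (suc m)) (mono-≢ {suc e} {0} (λ ()))) (ℤ.*-zeroˡ (f (suc m)))) (·-cong (mono-suc e) ≈-refl m))
          (ℤ.+-identityˡ _)

  mono-·-mono : ∀ a b → mono a · mono b ≈ mono (a +ℕ b)
  mono-·-mono zero    b m       = ·-identityˡ (mono b) m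
  mono-·-mono (suc a) b zero    = trans (mono-suc-·-zero a (mono b)) (sym (mono-≢ {suc (a +ℕ b)} {0} (λ ())))
  mono-·-mono (suc a) b (suc m) = trans (mono-suc-·-suc a (mono b) m)
                                        (trans (mono-·-mono a b m) (sym (mono-suc (a +ℕ b) m)))

  ·-zeroʳ : ∀ f → f · (λ _ → 0ℤ) ≈ (λ _ → 0ℤ)
  ·-zeroʳ f zero    = ℤ.*-zeroʳ (f 0)
  ·-zeroʳ f (suc m) = cong₂ _+_ (ℤ.*-zeroʳ (f 0)) (·-zeroʳ (f ∘ suc) m)

  gen : List ℕ → Poly
  gen es m = sumℤ (map (λ e → mono e m) es)

  gen-++ : ∀ xs ys → gen (xs ++ ys) ≈ gen xs +P gen ys
  gen-++ []       ys m = sym (ℤ.+-identityˡ _)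
  gen-++ (x ∷ xs) ys m = trans (cong (mono x m +_) (gen-++ xs ys m)) (sym (ℤ.+-assoc (mono x m) _ _))

  gen-map-+ : ∀ s xs → gen (map (s +ℕ_) xs) ≈ mono s · gen xs
  gen-map-+ s []       m = sym (·-zeroʳ (mono s) m)
  gen-map-+ s (x ∷ xs) m =
    trans (cong₂ _+_ (sym (mono-·-mono s x m)) (gen-map-+ s xs m)) (sym (·-distribˡ-+ (mono s) (mono x) (gen xs) m))

  gen-↭ : ∀ {xs ys} → xs ↭ ys → gen xs ≈ gen ys
  gen-↭ ↭.refl           m = refl
  gen-↭ (↭.prep x p)     m = cong (mono x m +_) (gen-↭ p m)
  gen-↭ (↭.swap x y p)   m = trans (sym (ℤ.+-assoc (mono x m) _ _))
    (trans (cong₂ _+_ (ℤ.+-comm (mono x m) (mono y m)) (gen-↭ p m)) (ℤ.+-assoc (mono y m) _ _))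
  gen-↭ (↭.trans p q)    m = trans (gen-↭ p m) (gen-↭ q m)

  genFun≈gen : ∀ ws stat → genFun ws stat ≈ gen (map stat ws)
  genFun≈gen ws stat m = cong sumℤ (List.map-∘ ws)

module GaussianBinomial where

  open Polynomial
  open import Data.Nat using (zero; suc; _<_; s≤s) renaming (_+_ to _+ℕ_; _*_ to _*ℕ_)
  import Data.Nat.Properties as ℕ
  open import Data.Integer using (_+_; -_)
  import Data.Integer.Properties as ℤ
  open import Data.Integer.Tactic.RingSolver using (solve-∀)
  open import Data.List using (List; []; _∷_; map; _++_)
  import Data.List.Properties as List
  open import Relation.Binary.PropositionalEquality
  open import Data.List.Relation.Binary.Permutation.Propositional
    using (_↭_; ↭-refl; ↭-trans; ↭-reflexive; module PermutationReasoning)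
  import Data.List.Relation.Binary.Permutation.Propositional.Properties as ↭
  open import Algebra.Solver.CommutativeMonoid ·-commutativeMonoid using (solve; _⊜_; _⊕_)

  -- [n k]_q = Σ_{e ∈ binomExps n k} q^e, through the recurrence [n+1 k+1] = [n k] + q^(k+1) [n k+1].
  binomExps : ℕ → ℕ → List ℕ
  binomExps n       zero    = 0 ∷ []
  binomExps zero    (suc k) = []
  binomExps (suc n) (suc k) = binomExps n k ++ map (suc k +ℕ_) (binomExps n (suc k))

  binomExps-< : ∀ {n k} → n < k → binomExps n k ≡ []
  binomExps-< {zero}  {suc k} _         = refl
  binomExps-< {suc n} {suc k} (s≤s n<k)
    rewrite binomExps-< n<k | binomExps-< (ℕ.m<n⇒m<1+n n<k) = refl

  binomExps-diagonal : ∀ n → binomExps n n ≡ 0 ∷ []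
  binomExps-diagonal zero    = refl
  binomExps-diagonal (suc n) rewrite binomExps-diagonal n | binomExps-< (ℕ.n<1+n n) = refl

  gaussian : ℕ → ℕ → ℕ → Poly
  gaussian d n k = gen (map (d *ℕ_) (binomExps n k))

  gaussian-pascal : ∀ d n k →
    gaussian d (suc n) (suc k) ≈ gaussian d n k +P mono (d *ℕ suc k) · gaussian d n (suc k)
  gaussian-pascal d n k m = begin
    gen (map (d *ℕ_) (binomExps n k ++ map (suc k +ℕ_) G)) m
      ≡⟨ cong (λ es → gen es m) (List.map-++ (d *ℕ_) (binomExps n k) _) ⟩
    gen (map (d *ℕ_) (binomExps n k) ++ map (d *ℕ_) (map (suc k +ℕ_) G)) m
      ≡⟨ gen-++ (map (d *ℕ_) (binomExps n k)) _ m ⟩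
    gaussian d n k m + gen (map (d *ℕ_) (map (suc k +ℕ_) G)) m
      ≡⟨ cong (λ es → gaussian d n k m + gen es m) shift-scaled ⟩
    gaussian d n k m + gen (map (d *ℕ suc k +ℕ_) (map (d *ℕ_) G)) m
      ≡⟨ cong (gaussian d n k m +_) (gen-map-+ (d *ℕ suc k) (map (d *ℕ_) G) m) ⟩
    gaussian d n k m + (mono (d *ℕ suc k) · gaussian d n (suc k)) m
      ∎
    where
    open ≡-Reasoning
    G = binomExps n (suc k)
    shift-scaled : map (d *ℕ_) (map (suc k +ℕ_) G) ≡ map (d *ℕ suc k +ℕ_) (map (d *ℕ_) G)
    shift-scaled = trans (sym (List.map-∘ G))
                         (trans (List.map-cong (ℕ.*-distribˡ-+ d (suc k)) G) (List.map-∘ G))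

  gaussian-diagonal : ∀ d n → gaussian d n n ≈ oneP
  gaussian-diagonal d n m rewrite binomExps-diagonal n | ℕ.*-zeroʳ d = ℤ.+-identityʳ (mono 0 m)

  gaussian-zero : ∀ d n → gaussian d n 0 ≈ oneP
  gaussian-zero d n m rewrite ℕ.*-zeroʳ d = ℤ.+-identityʳ (mono 0 m)

  qfac : ℕ → ℕ → Poly
  qfac d zero    = oneP
  qfac d (suc n) = qfac d n · (oneP -P mono (d *ℕ suc n))

  qfact₃≈qfac : ∀ n → qfact₃ n ≈ qfac 3 n
  qfact₃≈qfac zero    = ≈-refl
  qfact₃≈qfac (suc n) = ≈-trans (*P≈· (qfact₃ n) _) (·-cong (qfact₃≈qfac n) ≈-refl)

  one-minus-mono-+ : ∀ a b → (oneP -P mono a) +P (oneP -P mono b) · mono a ≈ oneP -P mono (a +ℕ b)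
  one-minus-mono-+ a b m = begin
    (oneP -P mono a) m + ((oneP -P mono b) · mono a) m
      ≡⟨ cong ((oneP -P mono a) m +_) (trans (·-comm _ (mono a) m) (·-distribˡ-∸ (mono a) oneP (mono b) m)) ⟩
    (oneP -P mono a) m + ((mono a · oneP) m + - (mono a · mono b) m)
      ≡⟨ cong₂ (λ x y → (oneP -P mono a) m + (x + - y))
               (trans (·-comm (mono a) oneP m) (·-identityˡ (mono a) m)) (mono-·-mono a b m) ⟩
    (oneP -P mono a) m + (mono a m + - mono (a +ℕ b) m)
      ≡⟨ telescope (oneP m) (mono a m) (mono (a +ℕ b) m) ⟩
    (oneP -P mono (a +ℕ b)) m
      ∎
    where
    open ≡-Reasoning
    telescope : ∀ x y z → x + - y + (y + - z) ≡ x + - z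
    telescope = solve-∀

  qfac-·-gaussian : ∀ d k j → qfac d k · qfac d j · gaussian d (k +ℕ j) k ≈ qfac d (k +ℕ j)
  qfac-·-gaussian d zero j = begin
    oneP · qfac d j · gaussian d j 0 ≈⟨ ·-cong (·-identityˡ (qfac d j)) (gaussian-zero d j) ⟩
    qfac d j · oneP                  ≈⟨ ·-identityʳ (qfac d j) ⟩
    qfac d j                         ∎
    where open ≈-Reasoning
  qfac-·-gaussian d (suc k) zero rewrite ℕ.+-identityʳ k = begin
    qfac d (suc k) · oneP · gaussian d (suc k) (suc k)
      ≈⟨ ·-cong (·-identityʳ (qfac d (suc k))) (gaussian-diagonal d (suc k)) ⟩
    qfac d (suc k) · oneP
      ≈⟨ ·-identityʳ (qfac d (suc k)) ⟩
    qfac d (suc k)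
      ∎
    where open ≈-Reasoning
  qfac-·-gaussian d (suc k) (suc j) = begin
    a · U · (c · V) · gaussian d (suc n) (suc k)
      ≈⟨ ·-cong ≈-refl (gaussian-pascal d n k) ⟩
    a · U · (c · V) · (gaussian d n k +P mono s · gaussian d n (suc k))
      ≈⟨ ·-distribˡ-+ (a · U · (c · V)) _ _ ⟩
    a · U · (c · V) · gaussian d n k +P a · U · (c · V) · (mono s · gaussian d n (suc k))
      ≈⟨ +P-cong (≈-trans (pull-U a U (c · V) _) (·-cong ≈-refl (qfac-·-gaussian d k (suc j))))
                 (≈-trans (pull-V·mono a U c V (mono s) _) (·-cong ≈-refl shifted-IH)) ⟩
    U · qfac d n +P V · mono s · qfac d n
      ≈⟨ ≈-sym (·-distribʳ-+ U (V · mono s) (qfac d n)) ⟩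
    (U +P V · mono s) · qfac d n
      ≈⟨ ·-cong (one-minus-mono-+ s (d *ℕ suc j)) ≈-refl ⟩
    (oneP -P mono (s +ℕ d *ℕ suc j)) · qfac d n
      ≈⟨ ·-comm _ (qfac d n) ⟩
    qfac d n · (oneP -P mono (s +ℕ d *ℕ suc j))
      ≈⟨ ·-cong {qfac d n} ≈-refl (λ m → cong (λ e → (oneP -P mono e) m) (sym (ℕ.*-distribˡ-+ d (suc k) (suc j)))) ⟩
    qfac d (suc n)
      ∎
    where
    open ≈-Reasoning
    a = qfac d k
    c = qfac d j
    s = d *ℕ suc k
    U = oneP -P mono s
    V = oneP -P mono (d *ℕ suc j)
    n = k +ℕ suc j
    shifted-IH : qfac d (suc k) · c · gaussian d n (suc k) ≈ qfac d n
    shifted-IH = subst (λ n → qfac d (suc k) · c · gaussian d n (suc k) ≈ qfac d n)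
                       (sym (ℕ.+-suc k j)) (qfac-·-gaussian d (suc k) j)
    pull-U : ∀ a u b g → a · u · b · g ≈ u · (a · b · g)
    pull-U = solve 4 (λ a u b g → ((a ⊕ u) ⊕ b) ⊕ g ⊜ u ⊕ ((a ⊕ b) ⊕ g)) ≈-refl
    pull-V·mono : ∀ a u c v t g → a · u · (c · v) · (t · g) ≈ v · t · (a · u · c · g)
    pull-V·mono = solve 6 (λ a u c v t g → ((a ⊕ u) ⊕ (c ⊕ v)) ⊕ (t ⊕ g) ⊜ (v ⊕ t) ⊕ (((a ⊕ u) ⊕ c) ⊕ g)) ≈-refl

  qfac-·-qfac-·-gaussian : ∀ d {n k} → k ≤ n → qfac d k · qfac d (n ∸ k) · gaussian d n k ≈ qfac d n
  qfac-·-qfac-·-gaussian d {n} {k} k≤n =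
    subst (λ m → qfac d k · qfac d (n ∸ k) · gaussian d m k ≈ qfac d m) (ℕ.m+[n∸m]≡n k≤n) (qfac-·-gaussian d k (n ∸ k))

  shift : ℕ → List ℕ → List ℕ
  shift c = map (c +ℕ_)

  shift-shift : ∀ a b xs → shift a (shift b xs) ≡ shift (a +ℕ b) xs
  shift-shift a b xs = trans (sym (List.map-∘ xs)) (List.map-cong (λ x → sym (ℕ.+-assoc a b x)) xs)

  shift-++ : ∀ a xs ys → shift a (xs ++ ys) ≡ shift a xs ++ shift a ys
  shift-++ a = List.map-++ (a +ℕ_)

  shift-zero : ∀ xs → shift 0 xs ≡ xs
  shift-zero = List.map-id

  shift-↭ : ∀ a {xs ys} → xs ↭ ys → shift a xs ↭ shift a ys
  shift-↭ a = ↭.map⁺ (a +ℕ_)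

  -- The other Pascal recurrence [n+1 k+1] = [n k+1] + q^(n-k) [n k].
  binomExps-pascal′ : ∀ k M n → n ≡ k +ℕ M →
    binomExps (suc n) (suc k) ↭ binomExps n (suc k) ++ shift M (binomExps n k)
  binomExps-pascal′ zero    zero    zero    refl = ↭-refl
  binomExps-pascal′ zero    (suc M) (suc n) eq   =
    ↭.++⁺ˡ (0 ∷ []) (↭-trans (shift-↭ 1 (binomExps-pascal′ zero M n (ℕ.suc-injective eq)))
                              (↭-reflexive (trans (shift-++ 1 (binomExps n 1) _)
                                                  (cong (shift 1 (binomExps n 1) ++_) (shift-shift 1 M (0 ∷ []))))))
  binomExps-pascal′ (suc k) zero    n       refl
    rewrite ℕ.+-identityʳ k | binomExps-< (ℕ.n<1+n (suc k)) | shift-zero (binomExps (suc k) (suc k)) =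
    ↭-reflexive (List.++-identityʳ _)
  binomExps-pascal′ (suc k) (suc M) (suc n) eq   = begin
    binomExps (suc n) (suc k) ++ shift (2 +ℕ k) (binomExps (suc n) (2 +ℕ k))
      ↭⟨ ↭.++⁺ (binomExps-pascal′ k (suc M) n n≡) (shift-↭ (2 +ℕ k) (binomExps-pascal′ (suc k) M n (trans n≡ (ℕ.+-suc k M)))) ⟩
    (A ++ shift (suc M) B) ++ shift (2 +ℕ k) (C ++ shift M A)
      ≡⟨ cong ((A ++ shift (suc M) B) ++_) (shift-++ (2 +ℕ k) C _) ⟩
    (A ++ shift (suc M) B) ++ (shift (2 +ℕ k) C ++ shift (2 +ℕ k) (shift M A))
      ≡⟨ List.++-assoc A _ _ ⟩
    A ++ (shift (suc M) B ++ (shift (2 +ℕ k) C ++ shift (2 +ℕ k) (shift M A)))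
      ↭⟨ ↭.++⁺ˡ A (↭.shifts (shift (suc M) B) (shift (2 +ℕ k) C)) ⟩
    A ++ (shift (2 +ℕ k) C ++ (shift (suc M) B ++ shift (2 +ℕ k) (shift M A)))
      ≡⟨ cong (λ xs → A ++ (shift (2 +ℕ k) C ++ (shift (suc M) B ++ xs))) shifts-commute ⟩
    A ++ (shift (2 +ℕ k) C ++ (shift (suc M) B ++ shift (suc M) (shift (suc k) A)))
      ≡⟨ sym (List.++-assoc A _ _) ⟩
    (A ++ shift (2 +ℕ k) C) ++ (shift (suc M) B ++ shift (suc M) (shift (suc k) A))
      ≡⟨ cong ((A ++ shift (2 +ℕ k) C) ++_) (sym (shift-++ (suc M) B _)) ⟩
    (A ++ shift (2 +ℕ k) C) ++ shift (suc M) (B ++ shift (suc k) A)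
      ∎
    where
    open PermutationReasoning
    n≡ : n ≡ k +ℕ suc M
    n≡ = ℕ.suc-injective eq
    A = binomExps n (suc k)
    B = binomExps n k
    C = binomExps n (2 +ℕ k)
    shifts-commute : shift (2 +ℕ k) (shift M A) ≡ shift (suc M) (shift (suc k) A)
    shifts-commute = trans (shift-shift (2 +ℕ k) M A)
                     (trans (cong (λ c → shift c A) (cong suc (trans (cong suc (ℕ.+-comm k M)) (sym (ℕ.+-suc M k)))))
                            (sym (shift-shift (suc M) (suc k) A)))

-- A pattern records, position by position, whether σ has a fixed point there (true) or a letter of α.
module Pattern where

  open import Data.Nat using (zero; suc; z≤n; s≤s) renaming (_+_ to _+ℕ_)
  import Data.Nat.Properties as ℕ
  open import Data.Bool using (Bool; true; false)
  open import Data.List using (List; []; _∷_; map; _++_; _∷ʳ_; length; replicate)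
  import Data.List.Properties as List
  open import Data.List.Reverse using (Reverse; []; _∶_∶ʳ_; reverseView)
  open import Data.List.Relation.Unary.All as All using (All; []; _∷_)
  import Data.List.Relation.Unary.All.Properties as All
  open import Data.List.Relation.Unary.Any using (here)
  open import Data.List.Membership.Propositional using (_∈_)
  open import Data.List.Membership.Propositional.Properties using (∈-map⁺; ∈-map⁻; ∈-++⁺ˡ; ∈-++⁺ʳ; ∈-++⁻)
  open import Data.List.Relation.Unary.Unique.Propositional using (Unique; []; _∷_)
  import Data.List.Relation.Unary.Unique.Propositional.Properties as Unique
  open import Data.Product using (_×_; _,_; ∃)
  open import Data.Sum using (inj₁; inj₂)
  open import Data.Empty using (⊥-elim)
  open import Relation.Binary.PropositionalEquality
  open import Relation.Nullary using (¬_)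

  items : List Bool → ℕ
  items []          = 0
  items (true ∷ P)  = items P
  items (false ∷ P) = suc (items P)

  items-∷ʳ-true : ∀ P → items (P ∷ʳ true) ≡ items P
  items-∷ʳ-true []          = refl
  items-∷ʳ-true (true ∷ P)  = items-∷ʳ-true P
  items-∷ʳ-true (false ∷ P) = cong suc (items-∷ʳ-true P)

  items-∷ʳ-false : ∀ P → items (P ∷ʳ false) ≡ suc (items P)
  items-∷ʳ-false []          = refl
  items-∷ʳ-false (true ∷ P)  = items-∷ʳ-false P
  items-∷ʳ-false (false ∷ P) = cong suc (items-∷ʳ-false P)

  items-replicate : ∀ n → items (replicate n false) ≡ n
  items-replicate zero    = refl
  items-replicate (suc n) = cong suc (items-replicate n)

  items≤length : ∀ P → items P ≤ length P
  items≤length []          = z≤n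
  items≤length (true ∷ P)  = ℕ.m≤n⇒m≤1+n (items≤length P)
  items≤length (false ∷ P) = s≤s (items≤length P)

  length-∷ʳ : ∀ {A : Set} (xs : List A) x → length (xs ∷ʳ x) ≡ suc (length xs)
  length-∷ʳ xs x = trans (List.length-++ xs) (ℕ.+-comm (length xs) 1)

  Shape : ℕ → ℕ → List Bool → Set
  Shape j M P = (items P ≡ j) × (length P ≡ j +ℕ M)

  -- Enumerated by their last entry, which is how maj changes along them.
  mutual
    patterns : ℕ → ℕ → List (List Bool)
    patterns j M = empty j M ++ (patternsᵀ j M ++ patternsᶠ j M)

    empty : ℕ → ℕ → List (List Bool)
    empty zero zero    = [] ∷ []
    empty zero (suc M) = []
    empty (suc j) M    = []

    patternsᵀ : ℕ → ℕ → List (List Bool)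
    patternsᵀ j zero    = []
    patternsᵀ j (suc M) = map (_∷ʳ true) (patterns j M)

    patternsᶠ : ℕ → ℕ → List (List Bool)
    patternsᶠ zero    M = []
    patternsᶠ (suc j) M = map (_∷ʳ false) (patterns j M)

  shape-∷ʳ-true : ∀ {j M P} → Shape j M P → Shape j (suc M) (P ∷ʳ true)
  shape-∷ʳ-true {j} {M} {P} (i , l) =
    trans (items-∷ʳ-true P) i , trans (length-∷ʳ P true) (trans (cong suc l) (sym (ℕ.+-suc j M)))

  shape-∷ʳ-false : ∀ {j M P} → Shape j M P → Shape (suc j) M (P ∷ʳ false)
  shape-∷ʳ-false {P = P} (i , l) = trans (items-∷ʳ-false P) (cong suc i) , trans (length-∷ʳ P false) (cong suc l)

  mutual
    patterns-shape : ∀ j M → All (Shape j M) (patterns j M)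
    patterns-shape j M = All.++⁺ (empty-shape j M) (All.++⁺ (patternsᵀ-shape j M) (patternsᶠ-shape j M))

    empty-shape : ∀ j M → All (Shape j M) (empty j M)
    empty-shape zero    zero    = (refl , refl) ∷ []
    empty-shape zero    (suc M) = []
    empty-shape (suc j) M       = []

    patternsᵀ-shape : ∀ j M → All (Shape j M) (patternsᵀ j M)
    patternsᵀ-shape j zero    = []
    patternsᵀ-shape j (suc M) = patternsᵀ-All {Shape j (suc M)} j M (λ _ s → s)

    patternsᶠ-shape : ∀ j M → All (Shape j M) (patternsᶠ j M)
    patternsᶠ-shape zero    M = []
    patternsᶠ-shape (suc j) M = patternsᶠ-All {Shape (suc j) M} j M (λ _ s → s)

    patternsᵀ-All : ∀ {Φ : List Bool → Set} j M →
      (∀ Q → Shape j (suc M) (Q ∷ʳ true) → Φ (Q ∷ʳ true)) → All Φ (patternsᵀ j (suc M))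
    patternsᵀ-All {Φ} j M f = All.map⁺ (All.map g (patterns-shape j M))
      where
      g : ∀ {Q} → Shape j M Q → Φ (Q ∷ʳ true)
      g {Q} s = f Q (shape-∷ʳ-true {j} {M} {Q} s)

    patternsᶠ-All : ∀ {Φ : List Bool → Set} j M →
      (∀ Q → Shape (suc j) M (Q ∷ʳ false) → Φ (Q ∷ʳ false)) → All Φ (patternsᶠ (suc j) M)
    patternsᶠ-All {Φ} j M f = All.map⁺ (All.map g (patterns-shape j M))
      where
      g : ∀ {Q} → Shape j M Q → Φ (Q ∷ʳ false)
      g {Q} s = f Q (shape-∷ʳ-false {j} {M} {Q} s)

  patterns-complete : ∀ P {j M} → Shape j M P → P ∈ patterns j M
  patterns-complete P = complete (reverseView P)
    where
    complete : ∀ {P} → Reverse P → ∀ {j M} → Shape j M P → P ∈ patterns j M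
    complete []                      {zero}  {zero}  _                 = here refl
    complete (P ∶ r ∶ʳ true)         {j}     {zero}  (refl , l)        =
      ⊥-elim (ℕ.<⇒≱ (s≤s (items≤length P))
                      (ℕ.≤-reflexive (trans (trans (sym (length-∷ʳ P true)) l)
                                            (trans (ℕ.+-identityʳ _) (items-∷ʳ-true P)))))
    complete (P ∶ r ∶ʳ true)         {j}     {suc M} (i , l)           =
      ∈-++⁺ʳ (empty j (suc M)) (∈-++⁺ˡ (∈-map⁺ (_∷ʳ true)
        (complete r (trans (sym (items-∷ʳ-true P)) i ,
                     ℕ.suc-injective (trans (sym (length-∷ʳ P true)) (trans l (ℕ.+-suc j M)))))))
    complete (P ∶ r ∶ʳ false)        {zero}          (i , _)           = ⊥-elim (ℕ.1+n≢0 (trans (sym (items-∷ʳ-false P)) i))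
    complete (P ∶ r ∶ʳ false)        {suc j} {M}     (i , l)           =
      ∈-++⁺ʳ (empty (suc j) M) (∈-++⁺ʳ (patternsᵀ (suc j) M) (∈-map⁺ (_∷ʳ false)
        (complete r (ℕ.suc-injective (trans (sym (items-∷ʳ-false P)) i) ,
                     ℕ.suc-injective (trans (sym (length-∷ʳ P false)) l)))))

  ends-true : ∀ j M {P} → P ∈ patternsᵀ j M → ∃ λ Q → P ≡ Q ∷ʳ true
  ends-true j (suc M) P∈ with ∈-map⁻ (_∷ʳ true) P∈
  ... | Q , _ , refl = Q , refl

  ends-false : ∀ j M {P} → P ∈ patternsᶠ j M → ∃ λ Q → P ≡ Q ∷ʳ false
  ends-false (suc j) M P∈ with ∈-map⁻ (_∷ʳ false) P∈
  ... | Q , _ , refl = Q , refl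

  empty-is-[] : ∀ j M {P} → P ∈ empty j M → P ≡ []
  empty-is-[] zero zero (here refl) = refl

  []≢∷ʳ : ∀ {b} → ¬ ∃ (λ (Q : List Bool) → [] ≡ Q ∷ʳ b)
  []≢∷ʳ ([]    , ())
  []≢∷ʳ (_ ∷ _ , ())

  mutual
    patterns-unique : ∀ j M → Unique (patterns j M)
    patterns-unique j M =
      Unique.++⁺ (empty-unique j M) (Unique.++⁺ (uniqueᵀ j M) (uniqueᶠ j M) last-differs) nonempty
      where
      last-differs : ∀ {P} → ¬ (P ∈ patternsᵀ j M × P ∈ patternsᶠ j M)
      last-differs (Pᵀ , Pᶠ) with ends-true j M Pᵀ | ends-false j M Pᶠ
      ... | Q , refl | Q′ , e = true≢false (List.∷ʳ-injectiveʳ Q Q′ e)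
        where
        true≢false : ¬ true ≡ false
        true≢false ()
      nonempty : ∀ {P} → ¬ (P ∈ empty j M × P ∈ patternsᵀ j M ++ patternsᶠ j M)
      nonempty {P} (P∈empty , P∈ends) with empty-is-[] j M P∈empty | ∈-++⁻ (patternsᵀ j M) P∈ends
      ... | refl | inj₁ Pᵀ = []≢∷ʳ (ends-true j M Pᵀ)
      ... | refl | inj₂ Pᶠ = []≢∷ʳ (ends-false j M Pᶠ)

    empty-unique : ∀ j M → Unique (empty j M)
    empty-unique zero    zero    = [] ∷ []
    empty-unique zero    (suc M) = []
    empty-unique (suc j) M       = []

    uniqueᵀ : ∀ j M → Unique (patternsᵀ j M)
    uniqueᵀ j zero    = []
    uniqueᵀ j (suc M) = Unique.map⁺ (List.∷ʳ-injectiveˡ _ _) (patterns-unique j M)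

    uniqueᶠ : ∀ j M → Unique (patternsᶠ j M)
    uniqueᶠ zero    M = []
    uniqueᶠ (suc j) M = Unique.map⁺ (List.∷ʳ-injectiveˡ _ _) (patterns-unique j M)

module Maj where

  open import Data.Nat using (suc) renaming (_+_ to _+ℕ_)
  import Data.Nat.Properties as ℕ
  open import Data.Bool using (Bool; if_then_else_)
  open import Data.List using (List; []; _∷_; _∷ʳ_; length)
  open import Relation.Binary.PropositionalEquality

  when : Bool → ℕ → ℕ
  when b n = if b then n else 0

  majWith : {A : Set} → (A → A → Bool) → ℕ → List A → ℕ
  majWith d i (x ∷ y ∷ r) = when (d x y) i +ℕ majWith d (suc i) (y ∷ r)
  majWith d i _           = 0

  majWith-∷ʳ : ∀ {A : Set} (d : A → A → Bool) i xs x y →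
               majWith d i (xs ∷ʳ x ∷ʳ y) ≡ majWith d i (xs ∷ʳ x) +ℕ when (d x y) (i +ℕ length xs)
  majWith-∷ʳ d i []           x y = trans (ℕ.+-identityʳ _) (cong (when (d x y)) (sym (ℕ.+-identityʳ i)))
  majWith-∷ʳ d i (z ∷ [])     x y =
    trans (cong (when (d z x) i +ℕ_) (majWith-∷ʳ d (suc i) [] x y))
          (trans (sym (ℕ.+-assoc (when (d z x) i) 0 _)) (cong (λ n → when (d z x) i +ℕ 0 +ℕ when (d x y) n) (sym (ℕ.+-suc i 0))))
  majWith-∷ʳ d i (z ∷ w ∷ xs) x y =
    trans (cong (when (d z w) i +ℕ_) (majWith-∷ʳ d (suc i) (w ∷ xs) x y))
          (trans (sym (ℕ.+-assoc (when (d z w) i) _ _))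
                 (cong (λ n → when (d z w) i +ℕ majWith d (suc i) (w ∷ xs ∷ʳ x) +ℕ when (d x y) n)
                       (sym (ℕ.+-suc i (suc (length xs))))))

-- Inserting fixed points into α according to a pattern: the maj of the resulting word only depends
-- on the pattern, on the descents between consecutive letters of α, and on which letters of α stay
-- above an adjacent inserted fixed point ("high" letters).
module InsertionMaj
  (high : ℕ → Bool) (itemDescent : ℕ → ℕ → Bool)
  (high-fall : ∀ j → high j ≡ true → high (suc j) ≡ false → itemDescent j (suc j) ≡ true)
  (high-rise : ∀ j → high j ≡ false → high (suc j) ≡ true → itemDescent j (suc j) ≡ false)
  where

  open import Data.Nat using (zero; suc; s≤s) renaming (_+_ to _+ℕ_)
  import Data.Nat.Properties as ℕ
  open import Data.Nat.Tactic.RingSolver using (solve-∀)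
  open import Data.Bool using (Bool; true; false; not)
  open import Data.List using (List; []; _∷_; map; _++_; _∷ʳ_; length; replicate)
  import Data.List.Properties as List
  open import Data.List.Relation.Unary.All using (All; []; _∷_)
  open import Data.List.Relation.Binary.Permutation.Propositional
    using (_↭_; ↭-refl; ↭-sym; ↭-reflexive; module PermutationReasoning)
  import Data.List.Relation.Binary.Permutation.Propositional.Properties as ↭
  open import Data.Product using (_,_)
  open import Relation.Binary.PropositionalEquality
  open import Function using (_∘_)
  open Maj
  open Pattern
  open GaussianBinomial using (binomExps; binomExps-<; binomExps-pascal′; shift; shift-shift; shift-++; shift-zero; shift-↭)

  data Entry : Set where
    fixed : Entry
    item  : ℕ → Entry

  descent : Entry → Entry → Bool
  descent fixed    fixed    = false
  descent fixed    (item j) = not (high j)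
  descent (item i) fixed    = high i
  descent (item i) (item j) = itemDescent i j

  entry : Bool → ℕ → Entry
  entry true  c = fixed
  entry false c = item (suc c)

  entries : ℕ → List Bool → List Entry
  entries c []          = []
  entries c (true ∷ P)  = fixed ∷ entries c P
  entries c (false ∷ P) = item (suc c) ∷ entries (suc c) P

  entries-∷ʳ : ∀ c P b → entries c (P ∷ʳ b) ≡ entries c P ∷ʳ entry b (c +ℕ items P)
  entries-∷ʳ c []          true  = refl
  entries-∷ʳ c []          false = cong (λ n → item (suc n) ∷ []) (sym (ℕ.+-identityʳ c))
  entries-∷ʳ c (true ∷ P)  b = cong (fixed ∷_) (entries-∷ʳ c P b)
  entries-∷ʳ c (false ∷ P) b = cong (item (suc c) ∷_)
    (trans (entries-∷ʳ (suc c) P b) (cong (λ n → entries (suc c) P ∷ʳ entry b n) (sym (ℕ.+-suc c (items P)))))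

  length-entries : ∀ c P → length (entries c P) ≡ length P
  length-entries c []          = refl
  length-entries c (true ∷ P)  = cong suc (length-entries c P)
  length-entries c (false ∷ P) = cong suc (length-entries (suc c) P)

  patternMaj : List Bool → ℕ
  patternMaj P = majWith descent 1 (entries 0 P)

  majs : List (List Bool) → List ℕ
  majs = map patternMaj

  itemsMaj : ℕ → ℕ
  itemsMaj j = patternMaj (replicate j false)

  patternMaj-∷ʳ : ∀ P b b′ → patternMaj (P ∷ʳ b ∷ʳ b′) ≡
    when (descent (entry b (items P)) (entry b′ (items (P ∷ʳ b)))) (suc (length P)) +ℕ patternMaj (P ∷ʳ b)
  patternMaj-∷ʳ P b b′ = begin
    majWith descent 1 (entries 0 (P ∷ʳ b ∷ʳ b′))
      ≡⟨ cong (majWith descent 1) (trans (entries-∷ʳ 0 (P ∷ʳ b) b′) (cong (_∷ʳ y) (entries-∷ʳ 0 P b))) ⟩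
    majWith descent 1 (entries 0 P ∷ʳ x ∷ʳ y)
      ≡⟨ majWith-∷ʳ descent 1 (entries 0 P) x y ⟩
    majWith descent 1 (entries 0 P ∷ʳ x) +ℕ when (descent x y) (suc (length (entries 0 P)))
      ≡⟨ cong₂ (λ es n → majWith descent 1 es +ℕ when (descent x y) (suc n)) (sym (entries-∷ʳ 0 P b)) (length-entries 0 P) ⟩
    patternMaj (P ∷ʳ b) +ℕ when (descent x y) (suc (length P))
      ≡⟨ ℕ.+-comm (patternMaj (P ∷ʳ b)) _ ⟩
    when (descent x y) (suc (length P)) +ℕ patternMaj (P ∷ʳ b)
      ∎
    where
    open ≡-Reasoning
    x = entry b (items P)
    y = entry b′ (items (P ∷ʳ b))

  itemsMaj-suc : ∀ j → itemsMaj (suc (suc j)) ≡ itemsMaj (suc j) +ℕ when (itemDescent (suc j) (suc (suc j))) (suc j)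
  itemsMaj-suc j = begin
    patternMaj (replicate (2 +ℕ j) false)
      ≡⟨ cong patternMaj (trans (replicate-∷ʳ (suc j)) (cong (_∷ʳ false) (replicate-∷ʳ j))) ⟩
    patternMaj (replicate j false ∷ʳ false ∷ʳ false)
      ≡⟨ patternMaj-∷ʳ (replicate j false) false false ⟩
    when (itemDescent (suc (items F)) (suc (items (F ∷ʳ false)))) (suc (length F)) +ℕ patternMaj (F ∷ʳ false)
      ≡⟨ cong₂ _+ℕ_ (cong₃ (λ a b c → when (itemDescent (suc a) (suc b)) (suc c))
                          (items-replicate j) (trans (items-∷ʳ-false F) (cong suc (items-replicate j))) (List.length-replicate j))
                    (cong patternMaj (sym (replicate-∷ʳ j))) ⟩
    when (itemDescent (suc j) (suc (suc j))) (suc j) +ℕ itemsMaj (suc j)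
      ≡⟨ ℕ.+-comm _ (itemsMaj (suc j)) ⟩
    itemsMaj (suc j) +ℕ when (itemDescent (suc j) (suc (suc j))) (suc j)
      ∎
    where
    open ≡-Reasoning
    F = replicate j false
    replicate-∷ʳ : ∀ n → replicate (suc n) false ≡ replicate n false ∷ʳ false
    replicate-∷ʳ zero    = refl
    replicate-∷ʳ (suc n) = cong (false ∷_) (replicate-∷ʳ n)

  majs-++ : ∀ Ps Qs → majs (Ps ++ Qs) ≡ majs Ps ++ majs Qs
  majs-++ = List.map-++ patternMaj

  majs-extend : ∀ b s {Ps} → All (λ P → patternMaj (P ∷ʳ b) ≡ s +ℕ patternMaj P) Ps →
                majs (map (_∷ʳ b) Ps) ≡ shift s (majs Ps)
  majs-extend b s []       = refl
  majs-extend b s (e ∷ es) = cong₂ _∷_ e (majs-extend b s es)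

  fixed-after-fixed : ∀ Q → patternMaj (Q ∷ʳ true ∷ʳ true) ≡ 0 +ℕ patternMaj (Q ∷ʳ true)
  fixed-after-fixed Q = patternMaj-∷ʳ Q true true

  fixed-after-item : ∀ {j M} Q → Shape (suc j) M (Q ∷ʳ false) →
    patternMaj (Q ∷ʳ false ∷ʳ true) ≡ when (high (suc j)) (suc j +ℕ M) +ℕ patternMaj (Q ∷ʳ false)
  fixed-after-item Q (i , l) =
    trans (patternMaj-∷ʳ Q false true)
          (cong₂ (λ a n → when (high (suc a)) n +ℕ patternMaj (Q ∷ʳ false))
                 (ℕ.suc-injective (trans (sym (items-∷ʳ-false Q)) i)) (trans (sym (length-∷ʳ Q false)) l))

  item-after-fixed : ∀ {j M} Q → Shape j (suc M) (Q ∷ʳ true) →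
    patternMaj (Q ∷ʳ true ∷ʳ false) ≡ when (not (high (suc j))) (j +ℕ suc M) +ℕ patternMaj (Q ∷ʳ true)
  item-after-fixed Q (i , l) =
    trans (patternMaj-∷ʳ Q true false)
          (cong₂ (λ a n → when (not (high (suc a))) n +ℕ patternMaj (Q ∷ʳ true)) i (trans (sym (length-∷ʳ Q true)) l))

  item-after-item : ∀ {j M} Q → Shape (suc j) M (Q ∷ʳ false) →
    patternMaj (Q ∷ʳ false ∷ʳ false) ≡ when (itemDescent (suc j) (suc (suc j))) (suc j +ℕ M) +ℕ patternMaj (Q ∷ʳ false)
  item-after-item Q (i , l) =
    trans (patternMaj-∷ʳ Q false false)
          (trans (cong (λ b → when (itemDescent (suc (items Q)) (suc b)) (suc (length Q)) +ℕ patternMaj (Q ∷ʳ false))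
                       (items-∷ʳ-false Q)) (cong₂ (λ a n → when (itemDescent (suc a) (suc (suc a))) n +ℕ patternMaj (Q ∷ʳ false))
                 (ℕ.suc-injective (trans (sym (items-∷ʳ-false Q)) i)) (trans (sym (length-∷ʳ Q false)) l)))

  majsᵀ-extend-true : ∀ j M → majs (map (_∷ʳ true) (patternsᵀ j M)) ≡ majs (patternsᵀ j M)
  majsᵀ-extend-true j zero    = refl
  majsᵀ-extend-true j (suc M) =
    trans (majs-extend true 0 (patternsᵀ-All j M (λ Q _ → fixed-after-fixed Q))) (shift-zero _)

  majsᵀ-zero : ∀ M → majs (patternsᵀ 0 (suc M)) ≡ 0 ∷ []
  majsᵀ-zero zero    = refl
  majsᵀ-zero (suc M) = trans (cong (majs ∘ map (_∷ʳ true)) (List.++-identityʳ (patternsᵀ 0 (suc M))))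
                             (trans (majsᵀ-extend-true 0 (suc M)) (majsᵀ-zero M))

  majsᶠ-one : ∀ M → majs (patternsᶠ 1 (suc M)) ≡ shift (when (not (high 1)) (suc M)) (majs (patternsᵀ 0 (suc M)))
  majsᶠ-one M = trans (cong (majs ∘ map (_∷ʳ false)) (List.++-identityʳ (patternsᵀ 0 (suc M))))
                      (majs-extend false _ (patternsᵀ-All 0 M (λ Q s → item-after-fixed Q s)))

  majsᵀ-rec : ∀ j M → majs (patternsᵀ (suc j) (suc M)) ≡
    majs (patternsᵀ (suc j) M) ++ shift (when (high (suc j)) (suc j +ℕ M)) (majs (patternsᶠ (suc j) M))
  majsᵀ-rec j M =
    trans (cong majs (List.map-++ (_∷ʳ true) (patternsᵀ (suc j) M) (patternsᶠ (suc j) M)))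
          (trans (majs-++ (map (_∷ʳ true) (patternsᵀ (suc j) M)) _) (cong₂ _++_ (majsᵀ-extend-true (suc j) M)
                                           (majs-extend true _ (patternsᶠ-All j M (λ Q s → fixed-after-item Q s)))))

  majsᶠ-rec : ∀ j M → majs (patternsᶠ (suc (suc j)) M) ≡
    shift (when (not (high (suc (suc j)))) (suc j +ℕ M)) (majs (patternsᵀ (suc j) M)) ++
    shift (when (itemDescent (suc j) (suc (suc j))) (suc j +ℕ M)) (majs (patternsᶠ (suc j) M))
  majsᶠ-rec j M =
    trans (cong majs (List.map-++ (_∷ʳ false) (patternsᵀ (suc j) M) (patternsᶠ (suc j) M)))
          (trans (majs-++ (map (_∷ʳ false) (patternsᵀ (suc j) M)) _) (cong₂ _++_ (majs-extend false _ (after-fixed M))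
                                           (majs-extend false _ (patternsᶠ-All j M (λ Q s → item-after-item Q s)))))
    where
    after-fixed : ∀ M → All (λ P → patternMaj (P ∷ʳ false) ≡ when (not (high (suc (suc j)))) (suc j +ℕ M) +ℕ patternMaj P)
                            (patternsᵀ (suc j) M)
    after-fixed zero    = []
    after-fixed (suc M) = patternsᵀ-All (suc j) M (λ Q s → item-after-fixed Q s)

  shift-shift-≡ : ∀ {a b c} xs → a +ℕ b ≡ c → shift a (shift b xs) ≡ shift c xs
  shift-shift-≡ {a} {b} xs refl = shift-shift a b xs

  when-zero : ∀ b → when b 0 ≡ 0
  when-zero true  = refl
  when-zero false = refl

  -- How the maj multisets of patterns ending in a fixed point (T) and in a letter (F) with j + 1 letters
  -- combine into those ending in a letter with j + 2 letters; the two excluded combinations of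
  -- h₁ = high (j + 1), h₂ = high (j + 2) and d = itemDescent (j + 1) (j + 2) cannot occur.
  extend-by-item : ∀ h₁ h₂ d j M m {T F A B : List ℕ} →
    (h₁ ≡ true → h₂ ≡ false → d ≡ true) → (h₁ ≡ false → h₂ ≡ true → d ≡ false) →
    T ↭ shift (m +ℕ when h₁ (suc j)) A → F ↭ shift (m +ℕ when (not h₁) M) B →
    T ++ F ↭ shift m (B ++ shift (suc j) A) → B ++ shift (suc j) A ↭ A ++ shift M B →
    shift (when (not h₂) (suc j +ℕ M)) T ++ shift (when d (suc j +ℕ M)) F ↭
    shift (m +ℕ when d (suc j) +ℕ when (not h₂) M) (B ++ shift (suc j) A)
  extend-by-item h₁ true false j M m {T} {F} {A} {B} _ _ _ _ T++F↭ _ = begin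
    shift 0 T ++ shift 0 F             ≡⟨ cong₂ _++_ (shift-zero T) (shift-zero F) ⟩
    T ++ F                             ↭⟨ T++F↭ ⟩
    shift m (B ++ shift (suc j) A)     ≡⟨ cong (λ c → shift c (B ++ shift (suc j) A)) (sym (trans (ℕ.+-identityʳ (m +ℕ 0)) (ℕ.+-identityʳ m))) ⟩
    shift (m +ℕ 0 +ℕ 0) (B ++ shift (suc j) A) ∎
    where open PermutationReasoning
  extend-by-item h₁ false true j M m {T} {F} {A} {B} _ _ _ _ T++F↭ _ = begin
    shift (suc j +ℕ M) T ++ shift (suc j +ℕ M) F ≡⟨ sym (shift-++ (suc j +ℕ M) T F) ⟩
    shift (suc j +ℕ M) (T ++ F)                  ↭⟨ shift-↭ (suc j +ℕ M) T++F↭ ⟩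
    shift (suc j +ℕ M) (shift m X)               ≡⟨ shift-shift-≡ X (arith j M m) ⟩
    shift (m +ℕ suc j +ℕ M) X                    ∎
    where
    open PermutationReasoning
    X = B ++ shift (suc j) A
    arith : ∀ j M m → suc j +ℕ M +ℕ m ≡ m +ℕ suc j +ℕ M
    arith = solve-∀
  extend-by-item true false false j M m fall _ _ _ _ _ with () ← fall refl refl
  extend-by-item false false false j M m {T} {F} {A} {B} _ _ T↭ F↭ _ _ = begin
    shift (suc j +ℕ M) T ++ shift 0 F                     ↭⟨ ↭.++⁺ (shift-↭ (suc j +ℕ M) T↭) (↭-reflexive (shift-zero F)) ⟩
    shift (suc j +ℕ M) (shift (m +ℕ 0) A) ++ F            ↭⟨ ↭.++⁺ˡ (shift (suc j +ℕ M) (shift (m +ℕ 0) A)) F↭ ⟩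
    shift (suc j +ℕ M) (shift (m +ℕ 0) A) ++ shift (m +ℕ M) B
      ↭⟨ ↭.++-comm (shift (suc j +ℕ M) (shift (m +ℕ 0) A)) _ ⟩
    shift (m +ℕ M) B ++ shift (suc j +ℕ M) (shift (m +ℕ 0) A)
      ≡⟨ cong₂ _++_ (cong (λ c → shift c B) (cong (_+ℕ M) (sym (ℕ.+-identityʳ m))))
                    (trans (shift-shift-≡ A (arith j M m)) (sym (shift-shift (m +ℕ 0 +ℕ M) (suc j) A))) ⟩
    shift (m +ℕ 0 +ℕ M) B ++ shift (m +ℕ 0 +ℕ M) (shift (suc j) A)
      ≡⟨ sym (shift-++ (m +ℕ 0 +ℕ M) B _) ⟩
    shift (m +ℕ 0 +ℕ M) (B ++ shift (suc j) A) ∎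
    where
    open PermutationReasoning
    arith : ∀ j M m → suc j +ℕ M +ℕ (m +ℕ 0) ≡ m +ℕ 0 +ℕ M +ℕ suc j
    arith = solve-∀
  extend-by-item false true true j M m _ rise _ _ _ _ with () ← rise refl refl
  extend-by-item true true true j M m {T} {F} {A} {B} _ _ T↭ F↭ _ pascal′ = begin
    shift 0 T ++ shift (suc j +ℕ M) F                     ↭⟨ ↭.++⁺ (↭-reflexive (shift-zero T)) (shift-↭ (suc j +ℕ M) F↭) ⟩
    T ++ shift (suc j +ℕ M) (shift (m +ℕ 0) B)            ↭⟨ ↭.++⁺ʳ _ T↭ ⟩
    shift (m +ℕ suc j) A ++ shift (suc j +ℕ M) (shift (m +ℕ 0) B)
      ≡⟨ cong₂ _++_ (cong (λ c → shift c A) (sym (ℕ.+-identityʳ (m +ℕ suc j))))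
                    (trans (shift-shift-≡ B (arith j M m)) (sym (shift-shift (m +ℕ suc j +ℕ 0) M B))) ⟩
    shift (m +ℕ suc j +ℕ 0) A ++ shift (m +ℕ suc j +ℕ 0) (shift M B)
      ≡⟨ sym (shift-++ (m +ℕ suc j +ℕ 0) A _) ⟩
    shift (m +ℕ suc j +ℕ 0) (A ++ shift M B)              ↭⟨ shift-↭ (m +ℕ suc j +ℕ 0) (↭-sym pascal′) ⟩
    shift (m +ℕ suc j +ℕ 0) (B ++ shift (suc j) A) ∎
    where
    open PermutationReasoning
    arith : ∀ j M m → suc j +ℕ M +ℕ (m +ℕ 0) ≡ m +ℕ suc j +ℕ 0 +ℕ M
    arith = solve-∀

  mutual
    majs-patterns : ∀ j M → majs (patterns j M) ↭ shift (itemsMaj j) (binomExps (j +ℕ M) j)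
    majs-patterns zero    zero    = ↭-refl
    majs-patterns zero    (suc M) =
      ↭-reflexive (trans (cong majs (List.++-identityʳ (patternsᵀ 0 (suc M)))) (majsᵀ-zero M))
    majs-patterns (suc j) M with high (suc j) | majs-patternsᵀ j M | majs-patternsᶠ j M
    ... | true  | T↭ | F↭ = begin
      majs (patterns (suc j) M)                ≡⟨ majs-++ (patternsᵀ (suc j) M) _ ⟩
      majs (patternsᵀ (suc j) M) ++ majs (patternsᶠ (suc j) M) ↭⟨ ↭.++⁺ T↭ F↭ ⟩
      shift (m +ℕ suc j) A ++ shift (m +ℕ 0) B ↭⟨ ↭.++-comm (shift (m +ℕ suc j) A) _ ⟩
      shift (m +ℕ 0) B ++ shift (m +ℕ suc j) A
        ≡⟨ cong₂ _++_ (cong (λ c → shift c B) (ℕ.+-identityʳ m)) (sym (shift-shift m (suc j) A)) ⟩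
      shift m B ++ shift m (shift (suc j) A)   ≡⟨ sym (shift-++ m B _) ⟩
      shift m (B ++ shift (suc j) A)           ∎
      where
      open PermutationReasoning
      m = itemsMaj (suc j)
      A = binomExps (j +ℕ M) (suc j)
      B = binomExps (j +ℕ M) j
    ... | false | T↭ | F↭ = begin
      majs (patterns (suc j) M)                ≡⟨ majs-++ (patternsᵀ (suc j) M) _ ⟩
      majs (patternsᵀ (suc j) M) ++ majs (patternsᶠ (suc j) M) ↭⟨ ↭.++⁺ T↭ F↭ ⟩
      shift (m +ℕ 0) A ++ shift (m +ℕ M) B
        ≡⟨ cong₂ _++_ (cong (λ c → shift c A) (ℕ.+-identityʳ m)) (sym (shift-shift m M B)) ⟩
      shift m A ++ shift m (shift M B)         ≡⟨ sym (shift-++ m A _) ⟩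
      shift m (A ++ shift M B)                 ↭⟨ shift-↭ m (↭-sym (binomExps-pascal′ j M (j +ℕ M) refl)) ⟩
      shift m (B ++ shift (suc j) A)           ∎
      where
      open PermutationReasoning
      m = itemsMaj (suc j)
      A = binomExps (j +ℕ M) (suc j)
      B = binomExps (j +ℕ M) j

    majs-patternsᵀ : ∀ j M → majs (patternsᵀ (suc j) M) ↭
                     shift (itemsMaj (suc j) +ℕ when (high (suc j)) (suc j)) (binomExps (j +ℕ M) (suc j))
    majs-patternsᵀ j zero
      rewrite binomExps-< {j +ℕ 0} {suc j} (s≤s (ℕ.≤-reflexive (ℕ.+-identityʳ j))) = ↭-refl
    majs-patternsᵀ j (suc M)
      with high (suc j) | majsᵀ-rec j M | majs-patternsᵀ j M | majs-patternsᶠ j M | majs-patterns (suc j) M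
    ... | true  | rec | T↭ | F↭ | _ = begin
      majs (patternsᵀ (suc j) (suc M))
        ≡⟨ rec ⟩
      majs (patternsᵀ (suc j) M) ++ shift (suc j +ℕ M) (majs (patternsᶠ (suc j) M))
        ↭⟨ ↭.++⁺ T↭ (shift-↭ (suc j +ℕ M) F↭) ⟩
      shift (m +ℕ suc j) A ++ shift (suc j +ℕ M) (shift (m +ℕ 0) B)
        ≡⟨ cong (shift (m +ℕ suc j) A ++_)
                (trans (shift-shift-≡ B (arith j M m)) (sym (shift-shift (m +ℕ suc j) M B))) ⟩
      shift (m +ℕ suc j) A ++ shift (m +ℕ suc j) (shift M B)
        ≡⟨ sym (shift-++ (m +ℕ suc j) A _) ⟩
      shift (m +ℕ suc j) (A ++ shift M B)
        ↭⟨ shift-↭ (m +ℕ suc j) (↭-sym (binomExps-pascal′ j M (j +ℕ M) refl)) ⟩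
      shift (m +ℕ suc j) (binomExps (suc j +ℕ M) (suc j))
        ≡⟨ cong (λ n → shift (m +ℕ suc j) (binomExps n (suc j))) (sym (ℕ.+-suc j M)) ⟩
      shift (m +ℕ suc j) (binomExps (j +ℕ suc M) (suc j)) ∎
      where
      open PermutationReasoning
      m = itemsMaj (suc j)
      A = binomExps (j +ℕ M) (suc j)
      B = binomExps (j +ℕ M) j
      arith : ∀ j M m → suc j +ℕ M +ℕ (m +ℕ 0) ≡ m +ℕ suc j +ℕ M
      arith = solve-∀
    ... | false | rec | _  | _  | A↭ = begin
      majs (patternsᵀ (suc j) (suc M))
        ≡⟨ rec ⟩
      majs (patternsᵀ (suc j) M) ++ shift 0 (majs (patternsᶠ (suc j) M))
        ≡⟨ cong (majs (patternsᵀ (suc j) M) ++_) (shift-zero _) ⟩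
      majs (patternsᵀ (suc j) M) ++ majs (patternsᶠ (suc j) M)
        ≡⟨ sym (majs-++ (patternsᵀ (suc j) M) _) ⟩
      majs (patterns (suc j) M)
        ↭⟨ A↭ ⟩
      shift (itemsMaj (suc j)) (binomExps (suc j +ℕ M) (suc j))
        ≡⟨ cong₂ (λ c n → shift c (binomExps n (suc j))) (sym (ℕ.+-identityʳ _)) (sym (ℕ.+-suc j M)) ⟩
      shift (itemsMaj (suc j) +ℕ 0) (binomExps (j +ℕ suc M) (suc j)) ∎
      where open PermutationReasoning

    majs-patternsᶠ : ∀ j M → majs (patternsᶠ (suc j) M) ↭
                     shift (itemsMaj (suc j) +ℕ when (not (high (suc j))) M) (binomExps (j +ℕ M) j)
    majs-patternsᶠ zero    zero    = ↭-reflexive (cong (λ c → c ∷ []) (sym (trans (ℕ.+-identityʳ _) (when-zero (not (high 1))))))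
    majs-patternsᶠ zero    (suc M) = ↭-reflexive (trans (majsᶠ-one M) (cong (shift _) (majsᵀ-zero M)))
    majs-patternsᶠ (suc j) M = begin
      majs (patternsᶠ (suc (suc j)) M)
        ≡⟨ majsᶠ-rec j M ⟩
      shift (when (not h₂) (suc j +ℕ M)) (majs (patternsᵀ (suc j) M)) ++ shift (when d (suc j +ℕ M)) (majs (patternsᶠ (suc j) M))
        ↭⟨ extend-by-item h₁ h₂ d j M m (high-fall (suc j)) (high-rise (suc j))
                          (majs-patternsᵀ j M) (majs-patternsᶠ j M)
                          (subst (_↭ shift m (binomExps (suc j +ℕ M) (suc j))) (majs-++ (patternsᵀ (suc j) M) _)
                                 (majs-patterns (suc j) M))
                          (binomExps-pascal′ j M (j +ℕ M) refl) ⟩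
      shift (m +ℕ when d (suc j) +ℕ when (not h₂) M) (binomExps (suc j +ℕ M) (suc j))
        ≡⟨ cong (λ c → shift (c +ℕ when (not h₂) M) (binomExps (suc j +ℕ M) (suc j))) (sym (itemsMaj-suc j)) ⟩
      shift (itemsMaj (suc (suc j)) +ℕ when (not h₂) M) (binomExps (suc j +ℕ M) (suc j)) ∎
      where
      open PermutationReasoning
      m  = itemsMaj (suc j)
      h₁ = high (suc j)
      h₂ = high (suc (suc j))
      d  = itemDescent (suc j) (suc (suc j))

module ListFacts where

  open import Data.Nat using (zero; suc; _<_; z≤n; s≤s; _≤?_)
  import Data.Nat.Properties as ℕ
  open import Data.List using (List; []; _∷_; map; _++_; length; filter)
  import Data.List.Properties as List
  open import Data.List.Relation.Unary.All as All using (All; []; _∷_)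
  import Data.List.Relation.Unary.All.Properties as All
  open import Data.List.Relation.Unary.Any using (here; there)
  open import Data.List.Membership.Propositional using (_∈_; _∉_)
  open import Data.List.Membership.Propositional.Properties using (∈-map⁺; ∈-map⁻; ∈-++⁺ˡ; ∈-++⁺ʳ; ∈-++⁻; ∈-∃++)
  open import Data.List.Membership.Propositional.Properties.WithK using (unique∧set⇒bag)
  open import Data.List.Membership.DecPropositional ℕ._≟_ using (_∈?_)
  open import Data.List.Relation.Unary.Unique.Propositional using (Unique; []; _∷_)
  import Data.List.Relation.Unary.Unique.Propositional.Properties as Unique
  open import Data.List.Relation.Binary.Permutation.Propositional as ↭ using (_↭_)
  import Data.List.Relation.Binary.Permutation.Propositional.Properties as ↭
  open import Data.List.Relation.Binary.BagAndSetEquality using (∼bag⇒↭)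
  open import Data.Product using (_×_; _,_; proj₁; proj₂)
  open import Data.Sum using (inj₁; inj₂)
  open import Data.Empty using (⊥-elim)
  open import Function using (mk⇔)
  open import Relation.Nullary using (¬_; yes; no)
  open import Relation.Binary.PropositionalEquality

  private variable
    A B : Set
    xs ys : List A

  Unique-resp-↭ : xs ↭ ys → Unique xs → Unique ys
  Unique-resp-↭ ↭.refl           u                          = u
  Unique-resp-↭ (↭.prep x p)     (x∉ ∷ u)                   = ↭.All-resp-↭ p x∉ ∷ Unique-resp-↭ p u
  Unique-resp-↭ (↭.swap x y p)   ((x≢y ∷ x∉) ∷ (y∉ ∷ u))    =
    (≢-sym x≢y ∷ ↭.All-resp-↭ p y∉) ∷ (↭.All-resp-↭ p x∉ ∷ Unique-resp-↭ p u)
  Unique-resp-↭ (↭.trans p q)    u                          = Unique-resp-↭ q (Unique-resp-↭ p u)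

  same-members⇒↭ : Unique xs → Unique ys → (∀ {z} → z ∈ xs → z ∈ ys) → (∀ {z} → z ∈ ys → z ∈ xs) → xs ↭ ys
  same-members⇒↭ uxs uys xs⊆ys ys⊆xs = ∼bag⇒↭ (unique∧set⇒bag uxs uys (mk⇔ xs⊆ys ys⊆xs))

  Unique-map-injectiveOn : (f : A → B) → Unique xs → (∀ {x y} → x ∈ xs → y ∈ xs → f x ≡ f y → x ≡ y) →
                           Unique (map f xs)
  Unique-map-injectiveOn {xs = []}     f []       inj = []
  Unique-map-injectiveOn {xs = x ∷ xs} f (x∉ ∷ u) inj =
    All.map⁺ (All.tabulate (λ y∈ fx≡fy → All.lookup x∉ y∈ (inj (here refl) (there y∈) fx≡fy)))
    ∷ Unique-map-injectiveOn f u (λ x∈ y∈ → inj (there x∈) (there y∈))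

  Unique-++⁻ʳ : ∀ (xs : List A) → Unique (xs ++ ys) → Unique ys
  Unique-++⁻ʳ []       u       = u
  Unique-++⁻ʳ (x ∷ xs) (_ ∷ u) = Unique-++⁻ʳ xs u

  Unique-++-disjoint : ∀ (xs : List A) {z} → Unique (xs ++ ys) → z ∈ xs → z ∉ ys
  Unique-++-disjoint (x ∷ xs) (x∉ ∷ u) (here refl) z∈ys = All.lookup x∉ (∈-++⁺ʳ xs z∈ys) refl
  Unique-++-disjoint (x ∷ xs) (_ ∷ u)  (there z∈)  z∈ys = Unique-++-disjoint xs u z∈ z∈ys

  ∈-delete : ∀ (xs : List A) {x z} → z ∈ xs ++ x ∷ ys → z ≢ x → z ∈ xs ++ ys
  ∈-delete xs z∈ z≢x with ∈-++⁻ xs z∈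
  ... | inj₁ z∈xs          = ∈-++⁺ˡ z∈xs
  ... | inj₂ (here refl)   = ⊥-elim (z≢x refl)
  ... | inj₂ (there z∈ys)  = ∈-++⁺ʳ xs z∈ys

  length-delete : ∀ (xs : List A) {x} → length (xs ++ x ∷ ys) ≡ suc (length (xs ++ ys))
  length-delete []       = refl
  length-delete (y ∷ xs) = cong suc (length-delete xs)

  Unique-⊂-length : ∀ {xs S : List A} {s} → Unique xs → (∀ {z} → z ∈ xs → z ∈ S) → s ∈ S → s ∉ xs →
                    length xs < length S
  Unique-⊂-length {xs = []}     {S = _ ∷ _} _        _     _  _  = s≤s z≤n
  Unique-⊂-length {xs = x ∷ xs} (x∉ ∷ u) xs⊆S s∈S s∉ with ∈-∃++ (xs⊆S (here refl))
  ... | S₁ , S₂ , refl =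
    ℕ.≤-trans (s≤s (Unique-⊂-length u (λ z∈ → ∈-delete S₁ (xs⊆S (there z∈)) (λ { refl → All.lookup x∉ z∈ refl }))
                                       (∈-delete S₁ s∈S (s∉ ∘′ here)) (s∉ ∘′ there)))
              (ℕ.≤-reflexive (sym (length-delete S₁)))
    where open import Function using (_∘′_)

  range : ℕ → List ℕ
  range zero    = []
  range (suc n) = 1 ∷ map suc (range n)

  ∈-range⁺ : ∀ {n x} → 1 ≤ x → x ≤ n → x ∈ range n
  ∈-range⁺ {suc n} {suc zero}    _ _         = here refl
  ∈-range⁺ {suc n} {suc (suc x)} _ (s≤s x≤n) = there (∈-map⁺ suc (∈-range⁺ (s≤s z≤n) x≤n))

  ∈-range⁻ : ∀ {n x} → x ∈ range n → (1 ≤ x) × (x ≤ n)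
  ∈-range⁻ {suc n} (here refl) = s≤s z≤n , s≤s z≤n
  ∈-range⁻ {suc n} (there x∈) with ∈-map⁻ suc x∈
  ... | y , y∈ , refl = s≤s z≤n , s≤s (proj₂ (∈-range⁻ y∈))

  length-range : ∀ n → length (range n) ≡ n
  length-range zero    = refl
  length-range (suc n) = cong suc (trans (List.length-map suc (range n)) (length-range n))

  range-unique : ∀ n → Unique (range n)
  range-unique zero    = []
  range-unique (suc n) = All.tabulate 1∉ ∷ Unique.map⁺ ℕ.suc-injective (range-unique n)
    where
    1∉ : ∀ {z} → z ∈ map suc (range n) → 1 ≢ z
    1∉ z∈ refl with ∈-map⁻ suc z∈
    ... | zero , 0∈ , _ with () ← proj₁ (∈-range⁻ 0∈)

  InRangeℕ : ℕ → ℕ → Set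
  InRangeℕ n x = (1 ≤ x) × (x ≤ n)

  Unique-in-range-complete : ∀ {n} {xs : List ℕ} → Unique xs → All (InRangeℕ n) xs → length xs ≡ n →
                             ∀ {v} → InRangeℕ n v → v ∈ xs
  Unique-in-range-complete {n} {xs} u in-range len {v} (1≤v , v≤n) with v ∈? xs
  ... | yes v∈ = v∈
  ... | no  v∉ = ⊥-elim (ℕ.<-irrefl (trans len (sym (length-range n)))
                           (Unique-⊂-length u (λ z∈ → let r = All.lookup in-range z∈ in ∈-range⁺ (proj₁ r) (proj₂ r))
                                            (∈-range⁺ 1≤v v≤n) v∉))

  ↭-range : ∀ {n} {xs : List ℕ} → Unique xs → All (InRangeℕ n) xs → length xs ≡ n → xs ↭ range n
  ↭-range {n} u in-range len =
    same-members⇒↭ u (range-unique n) (λ z∈ → let r = All.lookup in-range z∈ in ∈-range⁺ (proj₁ r) (proj₂ r))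
                                       (λ z∈ → Unique-in-range-complete u in-range len (∈-range⁻ z∈))

  count≤ : ℕ → List ℕ → ℕ
  count≤ a xs = length (filter (_≤? a) xs)

  count≤-↭ : ∀ a {xs ys} → xs ↭ ys → count≤ a xs ≡ count≤ a ys
  count≤-↭ a p = ↭.↭-length (↭.filter-↭ (_≤? a) p)

  count≤-map-suc : ∀ a xs → count≤ (suc a) (map suc xs) ≡ count≤ a xs
  count≤-map-suc a []       = refl
  count≤-map-suc a (x ∷ xs) with x ≤? a
  ... | yes x≤a = trans (cong length (List.filter-accept (_≤? suc a) {x = suc x} {xs = map suc xs} (s≤s x≤a)))
                        (trans (cong suc (count≤-map-suc a xs)) (sym (cong length (List.filter-accept (_≤? a) {x = x} {xs = xs} x≤a))))
  ... | no  x≰a = trans (cong length (List.filter-reject (_≤? suc a) {x = suc x} {xs = map suc xs} (λ { (s≤s x≤a) → x≰a x≤a })))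
                        (trans (count≤-map-suc a xs) (sym (cong length (List.filter-reject (_≤? a) {x = x} {xs = xs} x≰a))))

  count≤-range : ∀ {a n} → a ≤ n → count≤ a (range n) ≡ a
  count≤-range {zero}  {zero}  _         = refl
  count≤-range {zero}  {suc n} _         = none (range n)
    where
    none : ∀ xs → count≤ 0 (map suc xs) ≡ 0
    none []       = refl
    none (x ∷ xs) = none xs
  count≤-range {suc a} {suc n} (s≤s a≤n) = cong suc (trans (count≤-map-suc a (range n)) (count≤-range a≤n))

module Positions where

  open import Data.Nat using (zero; suc; _<_; z≤n; s≤s; _≤?_) renaming (_+_ to _+ℕ_)
  import Data.Nat.Properties as ℕ
  open import Data.Bool using (Bool; true; false)
  open import Data.List using (List; []; _∷_; _++_; length)
  import Data.List.Properties as List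
  open import Data.List.Relation.Unary.All as All using (All; []; _∷_)
  open import Data.List.Relation.Unary.AllPairs as AllPairs using (AllPairs; []; _∷_)
  open import Data.List.Relation.Unary.Any using (here; there)
  open import Data.List.Membership.Propositional using (_∈_; _∉_)
  open import Data.List.Relation.Unary.Unique.Propositional using (Unique)
  open import Data.Product using (_×_; _,_)
  open import Data.Sum using (_⊎_; inj₁; inj₂)
  open import Data.Empty using (⊥-elim)
  open import Relation.Nullary using (yes; no)
  open import Relation.Binary.Definitions using (tri<; tri≈; tri>)
  open import Relation.Binary.PropositionalEquality
  open import Data.List.Membership.Propositional.Properties using (∈-filter⁺)
  open Pattern using (items)
  open ListFacts using (count≤)

  itemPositions : ℕ → List Bool → List ℕ
  itemPositions i []          = []
  itemPositions i (true ∷ P)  = itemPositions (suc i) P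
  itemPositions i (false ∷ P) = i ∷ itemPositions (suc i) P

  fixedPositions : ℕ → List Bool → List ℕ
  fixedPositions i []          = []
  fixedPositions i (true ∷ P)  = i ∷ fixedPositions (suc i) P
  fixedPositions i (false ∷ P) = fixedPositions (suc i) P

  Increasing : List ℕ → Set
  Increasing = AllPairs _<_

  Increasing⇒Unique : ∀ {xs} → Increasing xs → Unique xs
  Increasing⇒Unique = AllPairs.map ℕ.<⇒≢

  itemPositions-≥ : ∀ i P → All (i ≤_) (itemPositions i P)
  itemPositions-≥ i []          = []
  itemPositions-≥ i (true ∷ P)  = All.map ℕ.<⇒≤ (itemPositions-≥ (suc i) P)
  itemPositions-≥ i (false ∷ P) = ℕ.≤-refl ∷ All.map ℕ.<⇒≤ (itemPositions-≥ (suc i) P)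

  fixedPositions-≥ : ∀ i P → All (i ≤_) (fixedPositions i P)
  fixedPositions-≥ i []          = []
  fixedPositions-≥ i (true ∷ P)  = ℕ.≤-refl ∷ All.map ℕ.<⇒≤ (fixedPositions-≥ (suc i) P)
  fixedPositions-≥ i (false ∷ P) = All.map ℕ.<⇒≤ (fixedPositions-≥ (suc i) P)

  itemPositions-increasing : ∀ i P → Increasing (itemPositions i P)
  itemPositions-increasing i []          = []
  itemPositions-increasing i (true ∷ P)  = itemPositions-increasing (suc i) P
  itemPositions-increasing i (false ∷ P) = itemPositions-≥ (suc i) P ∷ itemPositions-increasing (suc i) P

  fixedPositions-increasing : ∀ i P → Increasing (fixedPositions i P)
  fixedPositions-increasing i []          = []
  fixedPositions-increasing i (true ∷ P)  = fixedPositions-≥ (suc i) P ∷ fixedPositions-increasing (suc i) P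
  fixedPositions-increasing i (false ∷ P) = fixedPositions-increasing (suc i) P

  length-itemPositions : ∀ i P → length (itemPositions i P) ≡ items P
  length-itemPositions i []          = refl
  length-itemPositions i (true ∷ P)  = length-itemPositions (suc i) P
  length-itemPositions i (false ∷ P) = cong suc (length-itemPositions (suc i) P)

  positions-disjoint : ∀ i P {z} → z ∈ fixedPositions i P → z ∉ itemPositions i P
  positions-disjoint i (true ∷ P)  (here refl) z∈ = ℕ.<-irrefl refl (All.lookup (itemPositions-≥ (suc i) P) z∈)
  positions-disjoint i (true ∷ P)  (there z∈) z∈′ = positions-disjoint (suc i) P z∈ z∈′
  positions-disjoint i (false ∷ P) z∈ (here refl) = ℕ.<-irrefl refl (All.lookup (fixedPositions-≥ (suc i) P) z∈)
  positions-disjoint i (false ∷ P) z∈ (there z∈′) = positions-disjoint (suc i) P z∈ z∈′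

  Position : ℕ → List Bool → ℕ → Set
  Position i P z = (i ≤ z) × (z < i +ℕ length P)

  position-head : ∀ i b P → Position i (b ∷ P) i
  position-head i b P = ℕ.≤-refl , ℕ.m<m+n i (s≤s z≤n)

  position-tail : ∀ i b P {z} → Position (suc i) P z → Position i (b ∷ P) z
  position-tail i b P {z} (i<z , z<) = ℕ.<⇒≤ i<z , subst (z <_) (sym (ℕ.+-suc i (length P))) z<

  positions-bounded : ∀ i P {z} → z ∈ fixedPositions i P ⊎ z ∈ itemPositions i P → Position i P z
  positions-bounded i (true ∷ P)  (inj₁ (here refl)) = position-head i true P
  positions-bounded i (false ∷ P) (inj₂ (here refl)) = position-head i false P
  positions-bounded i (true ∷ P)  (inj₁ (there z∈))  = position-tail i true P (positions-bounded (suc i) P (inj₁ z∈))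
  positions-bounded i (true ∷ P)  (inj₂ z∈)          = position-tail i true P (positions-bounded (suc i) P (inj₂ z∈))
  positions-bounded i (false ∷ P) (inj₁ z∈)          = position-tail i false P (positions-bounded (suc i) P (inj₁ z∈))
  positions-bounded i (false ∷ P) (inj₂ (there z∈))  = position-tail i false P (positions-bounded (suc i) P (inj₂ z∈))

  positions-cover : ∀ i P {z} → Position i P z → z ∈ fixedPositions i P ⊎ z ∈ itemPositions i P
  positions-cover i [] (i≤z , z<i+0) =
    ⊥-elim (ℕ.<-irrefl refl (ℕ.<-≤-trans z<i+0 (ℕ.≤-trans (ℕ.≤-reflexive (ℕ.+-identityʳ i)) i≤z)))
  positions-cover i (b ∷ P) {z} (i≤z , z<) with i ℕ.≟ z
  ... | yes refl = here-by b
    where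
    here-by : ∀ b → i ∈ fixedPositions i (b ∷ P) ⊎ i ∈ itemPositions i (b ∷ P)
    here-by true  = inj₁ (here refl)
    here-by false = inj₂ (here refl)
  ... | no i≢z = later b (positions-cover (suc i) P (ℕ.≤∧≢⇒< i≤z i≢z , subst (z <_) (ℕ.+-suc i (length P)) z<))
    where
    later : ∀ b → z ∈ fixedPositions (suc i) P ⊎ z ∈ itemPositions (suc i) P →
            z ∈ fixedPositions i (b ∷ P) ⊎ z ∈ itemPositions i (b ∷ P)
    later true  (inj₁ z∈) = inj₁ (there z∈)
    later true  (inj₂ z∈) = inj₂ z∈
    later false (inj₁ z∈) = inj₁ z∈
    later false (inj₂ z∈) = inj₂ (there z∈)

  -- The a-th entry, counted from 1 (with junk value 0 outside 1 … length xs).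
  nth : List ℕ → ℕ → ℕ
  nth []       a             = 0
  nth (x ∷ xs) zero          = 0
  nth (x ∷ xs) (suc zero)    = x
  nth (x ∷ xs) (suc (suc a)) = nth xs (suc a)

  nth-∈ : ∀ xs {a} → 1 ≤ a → a ≤ length xs → nth xs a ∈ xs
  nth-∈ (x ∷ xs) {suc zero}    _ _         = here refl
  nth-∈ (x ∷ xs) {suc (suc a)} _ (s≤s a≤) = there (nth-∈ xs (s≤s z≤n) a≤)

  nth-++ : ∀ xs {x ys c} → length xs ≡ c → nth (xs ++ x ∷ ys) (suc c) ≡ x
  nth-++ []           refl = refl
  nth-++ (_ ∷ [])     refl = refl
  nth-++ (_ ∷ y ∷ xs) refl = nth-++ (y ∷ xs) refl

  module _ {xs} (inc : Increasing xs) where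

    nth-monotone : ∀ {a b} → 1 ≤ a → a < b → b ≤ length xs → nth xs a < nth xs b
    nth-monotone = go inc
      where
      go : ∀ {xs} → Increasing xs → ∀ {a b} → 1 ≤ a → a < b → b ≤ length xs → nth xs a < nth xs b
      go {x ∷ xs} (x< ∷ _)   {suc zero}    {suc zero}    _ (s≤s ()) _
      go {x ∷ xs} (x< ∷ _)   {suc zero}    {suc (suc b)} _ _ (s≤s b≤) = All.lookup x< (nth-∈ xs (s≤s z≤n) b≤)
      go {x ∷ xs} (_ ∷ inc′) {suc (suc a)} {suc (suc b)} _ (s≤s a<b) (s≤s b≤) = go inc′ (s≤s z≤n) a<b b≤

    nth-mono-≤ : ∀ {a b} → 1 ≤ a → a ≤ b → b ≤ length xs → nth xs a ≤ nth xs b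
    nth-mono-≤ 1≤a a≤b b≤ with ℕ.m≤n⇒m<n∨m≡n a≤b
    ... | inj₁ a<b  = ℕ.<⇒≤ (nth-monotone 1≤a a<b b≤)
    ... | inj₂ refl = ℕ.≤-refl

    nth-cancel-≤ : ∀ {a b} → 1 ≤ a → a ≤ length xs → 1 ≤ b → b ≤ length xs → nth xs a ≤ nth xs b → a ≤ b
    nth-cancel-≤ {a} {b} 1≤a a≤ 1≤b b≤ le with ℕ.<-cmp a b
    ... | tri< a<b _ _ = ℕ.<⇒≤ a<b
    ... | tri≈ _ a≡b _ = ℕ.≤-reflexive a≡b
    ... | tri> _ _ b<a = ⊥-elim (ℕ.<⇒≱ (nth-monotone 1≤b b<a a≤) le)

    nth-injective : ∀ {a b} → 1 ≤ a → a ≤ length xs → 1 ≤ b → b ≤ length xs → nth xs a ≡ nth xs b → a ≡ b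
    nth-injective 1≤a a≤ 1≤b b≤ e =
      ℕ.≤-antisym (nth-cancel-≤ 1≤a a≤ 1≤b b≤ (ℕ.≤-reflexive e)) (nth-cancel-≤ 1≤b b≤ 1≤a a≤ (ℕ.≤-reflexive (sym e)))

  nth-count≤ : ∀ {xs} → Increasing xs → ∀ {v} → v ∈ xs → nth xs (count≤ v xs) ≡ v
  nth-count≤ {x ∷ xs} (x< ∷ _) {v} (here refl) =
    cong (λ l → nth (v ∷ xs) (length l))
         (trans (List.filter-accept (_≤? v) {x = v} {xs = xs} ℕ.≤-refl)
                (cong (v ∷_) (List.filter-none (_≤? v) (All.map ℕ.<⇒≱ x<))))
  nth-count≤ {x ∷ xs} (x< ∷ inc) {v} (there v∈) =
    trans (cong (λ l → nth (x ∷ xs) (length l)) (List.filter-accept (_≤? v) {x = x} {xs = xs} (ℕ.<⇒≤ (All.lookup x< v∈))))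
          (step (count≤ v xs) refl)
    where
    nonempty : ∀ {ys : List ℕ} {y} → y ∈ ys → 1 ≤ length ys
    nonempty (here _)  = s≤s z≤n
    nonempty (there _) = s≤s z≤n
    count≤-pos : ∀ ys {v} → v ∈ ys → 1 ≤ count≤ v ys
    count≤-pos ys {v} v∈ = nonempty (∈-filter⁺ (_≤? v) v∈ ℕ.≤-refl)
    step : ∀ c → c ≡ count≤ v xs → nth (x ∷ xs) (suc c) ≡ v
    step zero    e = ⊥-elim (ℕ.<-irrefl refl (subst (1 ≤_) (sym e) (count≤-pos xs v∈)))
    step (suc c) e = trans (cong (nth xs) e) (nth-count≤ inc v∈)

module ColouredPermutations where

  open import Data.Nat using (zero; suc; z≤n; s≤s)
  import Data.Nat.Properties as ℕ
  open import Data.Fin using (toℕ)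
  open import Data.List using (List; []; _∷_; map; length; concatMap; allFin)
  import Data.List.Properties as List
  open import Data.List.Relation.Unary.All as All using (All; []; _∷_)
  import Data.List.Relation.Unary.All.Properties as All
  open import Data.List.Relation.Unary.AllPairs as AllPairs using ()
  import Data.List.Relation.Unary.AllPairs.Properties as AllPairs
  import Data.List.Relation.Unary.Any as Any
  open import Data.List.Relation.Unary.Any using (here)
  open import Data.List.Membership.Propositional using (_∈_)
  open import Data.List.Membership.Propositional.Properties
    using (∈-map⁺; ∈-map⁻; ∈-concatMap⁺; ∈-upTo⁺; ∈-allFin; ∈-filter⁺; ∈-filter⁻)
  open import Data.List.Relation.Unary.Unique.Propositional using (Unique; []; _∷_)
  import Data.List.Relation.Unary.Unique.Propositional.Properties as Unique
  open import Data.Product using (_,_; proj₁; proj₂)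
  open import Data.Empty using (⊥)
  open import Relation.Nullary using (¬_; Dec; yes; no)
  open import Relation.Binary.PropositionalEquality

  private variable A B : Set

  colour? : ∀ j (x : CLetter) → Dec (toℕ (proj₂ x) ≡ j)
  colour? j x = toℕ (proj₂ x) ℕ.≟ j

  N-∷-cong : ∀ j x y {w v} → proj₂ x ≡ proj₂ y → N j w ≡ N j v → N j (x ∷ w) ≡ N j (y ∷ v)
  N-∷-cong j x y {w} {v} refl e with toℕ (proj₂ x) ℕ.≟ j
  ... | yes c≡j = trans (cong length (List.filter-accept (colour? j) {x = x} {xs = w} c≡j))
                        (trans (cong suc e) (sym (cong length (List.filter-accept (colour? j) {x = y} {xs = v} c≡j))))
  ... | no  c≢j = trans (cong length (List.filter-reject (colour? j) {x = x} {xs = w} c≢j))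
                        (trans e (sym (cong length (List.filter-reject (colour? j) {x = y} {xs = v} c≢j))))


  Unique-concatMap : ∀ (f : A → List B) {xs} → Unique xs → (∀ x → Unique (f x)) →
    (∀ {x y} → x ≢ y → ∀ {z} → z ∈ f x → z ∈ f y → ⊥) → Unique (concatMap f xs)
  Unique-concatMap f u uf disjoint =
    Unique.concat⁺ (All.map⁺ (All.tabulate (λ {x} _ → uf x)))
                   (AllPairs.map⁺ (AllPairs.map (λ x≢y → λ { (z∈fx , z∈fy) → disjoint x≢y z∈fx z∈fy }) u))

  words-unique : ∀ m (letters : List CLetter) → Unique letters → Unique (words m letters)
  words-unique zero    letters u = [] ∷ []
  words-unique (suc m) letters u =
    Unique-concatMap (λ x → map (x ∷_) (words m letters)) u
      (λ x → Unique.map⁺ (λ e → proj₂ (List.∷-injective e)) (words-unique m letters u))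
      (λ x≢y z∈ z∈′ → x≢y (same-head z∈ z∈′))
    where
    same-head : ∀ {x y z} → z ∈ map (x ∷_) (words m letters) → z ∈ map (y ∷_) (words m letters) → x ≡ y
    same-head {x} {y} z∈ z∈′ with ∈-map⁻ (x ∷_) z∈ | ∈-map⁻ (y ∷_) z∈′
    ... | _ , _ , refl | _ , _ , e = proj₁ (List.∷-injective e)

  alphabet-unique : ∀ n → Unique (alphabet n)
  alphabet-unique n =
    Unique-concatMap (λ a → map (λ c → (suc a , c)) (allFin 3)) (Unique.upTo⁺ n)
      (λ a → Unique.map⁺ {f = λ c → (suc a , c)} (cong proj₂) (Unique.allFin⁺ 3))
      (λ a≢b z∈ z∈′ → a≢b (same-letter z∈ z∈′))
    where
    same-letter : ∀ {a b z} → z ∈ map (λ c → (suc a , c)) (allFin 3) → z ∈ map (λ c → (suc b , c)) (allFin 3) → a ≡ b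
    same-letter {a} {b} z∈ z∈′ with ∈-map⁻ (λ c → (suc a , c)) z∈ | ∈-map⁻ (λ c → (suc b , c)) z∈′
    ... | _ , _ , refl | _ , _ , e = ℕ.suc-injective (cong proj₁ e)

  ∈-alphabet : ∀ {n x} → InRange n x → x ∈ alphabet n
  ∈-alphabet {n} {suc a , c} (s≤s z≤n , a<n) =
    ∈-concatMap⁺ (λ a → map (λ c → (suc a , c)) (allFin 3))
                 (Any.map (λ { refl → ∈-map⁺ (λ c → (suc a , c)) (∈-allFin c) }) (∈-upTo⁺ a<n))

  ∈-words : ∀ m (letters : List CLetter) (w : Word) → length w ≡ m → All (_∈ letters) w → w ∈ words m letters
  ∈-words zero    letters []      refl []          = here refl
  ∈-words (suc m) letters (x ∷ w) len  (x∈ ∷ w⊆) =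
    ∈-concatMap⁺ (λ x → map (x ∷_) (words m letters))
                 (Any.map (λ { refl → ∈-map⁺ (x ∷_) (∈-words m letters w (ℕ.suc-injective len) w⊆) }) x∈)

  ∈-S³⁺ : ∀ {n w} → IsColPerm n w → w ∈ S³ n
  ∈-S³⁺ {n} {w} σ@(len , in-range , _) =
    ∈-filter⁺ (isColPerm? n) (∈-words n (alphabet n) w len (All.map ∈-alphabet in-range)) σ

  ∈-S³⁻ : ∀ {n w} → w ∈ S³ n → IsColPerm n w
  ∈-S³⁻ {n} w∈ = proj₂ (∈-filter⁻ (isColPerm? n) {xs = words n (alphabet n)} w∈)

  S³-unique : ∀ n → Unique (S³ n)
  S³-unique n = Unique.filter⁺ (isColPerm? n) (words-unique n (alphabet n) (alphabet-unique n))

module Booleans where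

  open import Data.Nat using (zero; suc; _<_; _<ᵇ_; z≤n; s≤s)
  open import Data.Bool using (true; false)
  open import Relation.Binary.PropositionalEquality

  <ᵇ-true : ∀ {m n} → m < n → (m <ᵇ n) ≡ true
  <ᵇ-true {zero}  {suc n} _         = refl
  <ᵇ-true {suc m} {suc n} (s≤s m<n) = <ᵇ-true m<n

  <ᵇ-false : ∀ {m n} → n ≤ m → (m <ᵇ n) ≡ false
  <ᵇ-false {m}     {zero}  _         = refl
  <ᵇ-false {suc m} {suc n} (s≤s n≤m) = <ᵇ-false n≤m

  <ᵇ-true⁻ : ∀ m n → (m <ᵇ n) ≡ true → m < n
  <ᵇ-true⁻ zero    (suc n) _ = s≤s z≤n
  <ᵇ-true⁻ (suc m) (suc n) e = s≤s (<ᵇ-true⁻ m n e)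

  <ᵇ-false⁻ : ∀ m n → (m <ᵇ n) ≡ false → n ≤ m
  <ᵇ-false⁻ m       zero    _  = z≤n
  <ᵇ-false⁻ zero    (suc n) ()
  <ᵇ-false⁻ (suc m) (suc n) e  = s≤s (<ᵇ-false⁻ m n e)

module FixedPointPattern where

  open import Data.Nat using (suc)
  open import Data.Bool using (true; false)
  open import Data.Fin as Fin using ()
  open import Data.List using (List; []; _∷_; _++_; map; length)
  open import Data.List.Relation.Binary.Permutation.Propositional using (_↭_; ↭-refl; ↭-prep; ↭-trans; ↭-sym)
  import Data.List.Relation.Binary.Permutation.Propositional.Properties as ↭
  open import Data.Product using (_,_; proj₁)
  open import Relation.Nullary using (yes; no)
  open import Relation.Binary.PropositionalEquality
  open Pattern using (items)
  open Positions using (fixedPositions)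

  fixedPattern : ℕ → Word → List Bool
  fixedPattern i []      = []
  fixedPattern i (x ∷ w) with x ≟ᶜ (i , Fin.zero)
  ... | yes _ = true ∷ fixedPattern (suc i) w
  ... | no  _ = false ∷ fixedPattern (suc i) w

  length-fixedPattern : ∀ i w → length (fixedPattern i w) ≡ length w
  length-fixedPattern i []      = refl
  length-fixedPattern i (x ∷ w) with x ≟ᶜ (i , Fin.zero)
  ... | yes _ = cong suc (length-fixedPattern (suc i) w)
  ... | no  _ = cong suc (length-fixedPattern (suc i) w)

  items-fixedPattern : ∀ i w → items (fixedPattern i w) ≡ length (delFixed i w)
  items-fixedPattern i []      = refl
  items-fixedPattern i (x ∷ w) with x ≟ᶜ (i , Fin.zero)
  ... | yes _ = items-fixedPattern (suc i) w
  ... | no  _ = cong suc (items-fixedPattern (suc i) w)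

  values-↭ : ∀ i w → map proj₁ w ↭ fixedPositions i (fixedPattern i w) ++ map proj₁ (delFixed i w)
  values-↭ i []      = ↭-refl
  values-↭ i (x ∷ w) with x ≟ᶜ (i , Fin.zero)
  ... | yes refl = ↭-prep i (values-↭ (suc i) w)
  ... | no  _    = ↭-trans (↭-prep (proj₁ x) (values-↭ (suc i) w))
                           (↭-sym (↭.shift (proj₁ x) (fixedPositions (suc i) (fixedPattern (suc i) w)) _))

module Derangement (α : Word) (k : ℕ) (hα : IsDerangement k α) where

  open import Data.Nat using (zero; suc; _*_; _<_; _<ᵇ_; _≡ᵇ_; _≤?_; z≤n; s≤s) renaming (_+_ to _+ℕ_)
  import Data.Nat.Properties as ℕ
  open import Data.Bool using (_∧_; _∨_; not)
  open import Data.Fin as Fin using (Fin; toℕ)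
  open import Data.List using (List; []; _∷_; _++_; length; lookup; map; replicate)
  import Data.List.Properties as List
  open import Data.List.Relation.Unary.All as All using (All; []; _∷_)
  import Data.List.Relation.Unary.All.Properties as All
  open import Data.List.Relation.Unary.Any using (here; there)
  open import Data.List.Membership.Propositional using (_∈_; _∉_)
  open import Data.List.Membership.Propositional.Properties using (∈-++⁺ʳ; ∈-++⁻; ∈-map⁺; ∈-map⁻)
  open import Data.List.Relation.Unary.Unique.Propositional using (Unique)
  import Data.List.Relation.Unary.Unique.Propositional.Properties as Unique
  open import Data.List.Relation.Binary.Permutation.Propositional using (_↭_; ↭-refl; ↭-prep; ↭-trans; ↭-sym)
  import Data.List.Relation.Binary.Permutation.Propositional.Properties as ↭
  open import Data.Product using (_×_; _,_; proj₁; proj₂)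
  open import Data.Sum using (inj₁; inj₂)
  open import Data.Unit using (⊤; tt)
  open import Data.Empty using (⊥-elim)
  open import Function using (_∘_)
  open import Relation.Nullary using (yes; no)
  open import Relation.Binary.Definitions using (tri<; tri≈; tri>)
  open import Relation.Binary.PropositionalEquality
  open Maj using (when; majWith)
  open Booleans
  open ListFacts
  open ColouredPermutations using (N-∷-cong)
  open FixedPointPattern

  letterAt : Word → ℕ → CLetter
  letterAt []      j             = (0 , Fin.zero)
  letterAt (x ∷ w) zero          = (0 , Fin.zero)
  letterAt (x ∷ w) (suc zero)    = x
  letterAt (x ∷ w) (suc (suc j)) = letterAt w (suc j)

  letterAt-++ : ∀ u {x w c} → length u ≡ c → letterAt (u ++ x ∷ w) (suc c) ≡ x
  letterAt-++ []           refl = refl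
  letterAt-++ (_ ∷ [])     refl = refl
  letterAt-++ (_ ∷ y ∷ u)  refl = letterAt-++ (y ∷ u) refl

  -- a_c stays above a fixed point j_0 or (j+1)_0 next to it exactly when c = 0 and a > j.
  Above : ℕ → CLetter → Bool
  Above j (a , c) = (toℕ c ≡ᵇ 0) ∧ (j <ᵇ a)

  high : ℕ → Bool
  high j = Above j (letterAt α j)

  itemDescent : ℕ → ℕ → Bool
  itemDescent i j = letterAt α j <ᶜ letterAt α i

  above-fall : ∀ j x y → y ≢ (suc j , Fin.zero) → Above j x ≡ true → Above (suc j) y ≡ false → (y <ᶜ x) ≡ true
  above-fall j (a , Fin.zero)  (b , Fin.suc d) _  _  _  = refl
  above-fall j (a , Fin.suc c) (b , d)         _  () _
  above-fall j (a , Fin.zero)  (b , Fin.zero)  y≢ j<a b≤ with ℕ.m≤n⇒m<n∨m≡n (<ᵇ-false⁻ (suc j) b b≤)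
  ... | inj₁ (s≤s b≤j) = <ᵇ-true (ℕ.≤-<-trans b≤j (<ᵇ-true⁻ j a j<a))
  ... | inj₂ refl      = ⊥-elim (y≢ refl)

  above-rise : ∀ j x y → Above j x ≡ false → Above (suc j) y ≡ true → (y <ᶜ x) ≡ false
  above-rise j x               (b , Fin.suc d) _   ()
  above-rise j (a , Fin.suc c) (b , Fin.zero)  _   _   = refl
  above-rise j (a , Fin.zero)  (b , Fin.zero)  a≤j sj<b =
    <ᵇ-false (ℕ.≤-trans (<ᵇ-false⁻ j a a≤j) (ℕ.<⇒≤ (ℕ.<-trans (ℕ.n<1+n j) (<ᵇ-true⁻ (suc j) b sj<b))))

  FixedPointFreeFrom : ℕ → Word → Set
  FixedPointFreeFrom i []      = ⊤
  FixedPointFreeFrom i (x ∷ w) = (x ≢ (i , Fin.zero)) × FixedPointFreeFrom (suc i) w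

  fixedPointFreeFrom : ∀ w c → (∀ (i : Fin (length w)) → lookup w i ≢ (suc c +ℕ toℕ i , Fin.zero)) →
                       FixedPointFreeFrom (suc c) w
  fixedPointFreeFrom []      c free = tt
  fixedPointFreeFrom (x ∷ w) c free =
    (λ e → free Fin.zero (trans e (cong (λ n → (suc n , Fin.zero)) (sym (ℕ.+-identityʳ c))))) ,
    fixedPointFreeFrom w (suc c) (λ i e → free (Fin.suc i) (trans e (cong (λ n → (suc n , Fin.zero)) (sym (ℕ.+-suc c (toℕ i))))))

  letterAt-not-fixed : ∀ w c → FixedPointFreeFrom (suc c) w → ∀ j → letterAt w (suc j) ≢ (suc c +ℕ j , Fin.zero)
  letterAt-not-fixed (x ∷ w) c (x≢ , free) zero    e = x≢ (trans e (cong (λ n → (suc n , Fin.zero)) (ℕ.+-identityʳ c)))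
  letterAt-not-fixed (x ∷ w) c (x≢ , free) (suc j) e =
    letterAt-not-fixed w (suc c) free j (trans e (cong (λ n → (suc n , Fin.zero)) (ℕ.+-suc c j)))

  InRangeα : ℕ → Set
  InRangeα a = (1 ≤ a) × (a ≤ k)

  length-α : length α ≡ k
  length-α = proj₁ (proj₁ hα)

  α-in-range : All (InRange k) α
  α-in-range = proj₁ (proj₂ (proj₁ hα))

  α-unique : Unique (map proj₁ α)
  α-unique = proj₂ (proj₂ (proj₁ hα))

  α-fixed-point-free : FixedPointFreeFrom 1 α
  α-fixed-point-free = fixedPointFreeFrom α 0 (proj₂ hα)

  high-fall : ∀ j → high j ≡ true → high (suc j) ≡ false → itemDescent j (suc j) ≡ true
  high-fall j = above-fall j (letterAt α j) (letterAt α (suc j)) (letterAt-not-fixed α 0 α-fixed-point-free j)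

  high-rise : ∀ j → high j ≡ false → high (suc j) ≡ true → itemDescent j (suc j) ≡ false
  high-rise j = above-rise j (letterAt α j) (letterAt α (suc j))

  open InsertionMaj high itemDescent high-fall high-rise public

  -- Filling a pattern: fixed points at its fixed-point positions, and the letters of α in order at its
  -- letter positions, each value a renamed to the a-th letter position.
  module Filling (P : List Bool) where

    open Pattern using (items)
    open Positions

    places : List ℕ
    places = itemPositions 1 P

    place : ℕ → ℕ
    place = nth places

    relabel : CLetter → CLetter
    relabel (a , c) = (place a , c)

    fillFrom : ℕ → List Bool → Word → Word
    fillFrom i []          as       = []
    fillFrom i (true ∷ p)  as       = (i , Fin.zero) ∷ fillFrom (suc i) p as
    fillFrom i (false ∷ p) []       = []
    fillFrom i (false ∷ p) (x ∷ as) = relabel x ∷ fillFrom (suc i) p as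

    fill : Word
    fill = fillFrom 1 P α

    module _ (items-P : items P ≡ k) where

      length-places : length places ≡ k
      length-places = trans (length-itemPositions 1 P) items-P

      places-increasing : Increasing places
      places-increasing = itemPositions-increasing 1 P

      ≤k⇒≤length : ∀ {a} → a ≤ k → a ≤ length places
      ≤k⇒≤length = subst (_ ≤_) (sym length-places)

      place-∈ : ∀ {a} → InRangeα a → place a ∈ places
      place-∈ (1≤a , a≤k) = nth-∈ places 1≤a (≤k⇒≤length a≤k)

      place-monotone : ∀ {a b} → 1 ≤ a → a < b → b ≤ k → place a < place b
      place-monotone 1≤a a<b b≤k = nth-monotone places-increasing 1≤a a<b (≤k⇒≤length b≤k)

      place-injective : ∀ {a b} → InRangeα a → InRangeα b → place a ≡ place b → a ≡ b
      place-injective (1≤a , a≤k) (1≤b , b≤k) =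
        nth-injective places-increasing 1≤a (≤k⇒≤length a≤k) 1≤b (≤k⇒≤length b≤k)

      place-<ᵇ : ∀ {a b} → InRangeα a → InRangeα b → (place b <ᵇ place a) ≡ (b <ᵇ a)
      place-<ᵇ {a} {b} (1≤a , a≤k) (1≤b , b≤k) with ℕ.<-cmp b a
      ... | tri< b<a _ _ = trans (<ᵇ-true (place-monotone 1≤b b<a a≤k)) (sym (<ᵇ-true b<a))
      ... | tri≈ _ refl _ = trans (<ᵇ-false (ℕ.≤-refl {place a})) (sym (<ᵇ-false (ℕ.≤-refl {a})))
      ... | tri> _ _ a<b = trans (<ᵇ-false (ℕ.<⇒≤ (place-monotone 1≤a a<b b≤k))) (sym (<ᵇ-false (ℕ.<⇒≤ a<b)))

      -- The state after filling the positions before i, of which c received letters of α.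
      record Progress (i c : ℕ) (p : List Bool) (as : Word) : Set where
        field
          donePlaces         : List ℕ
          places≡            : places ≡ donePlaces ++ itemPositions i p
          length-donePlaces  : length donePlaces ≡ c
          donePlaces<i       : All (_< i) donePlaces
          doneLetters        : Word
          α≡                 : α ≡ doneLetters ++ as
          length-doneLetters : length doneLetters ≡ c
          items≡             : items p ≡ length as
          rest-free          : FixedPointFreeFrom (suc c) as

      open Progress

      start : Progress 1 0 P α
      start = record
        { donePlaces = [] ; places≡ = refl ; length-donePlaces = refl ; donePlaces<i = []
        ; doneLetters = [] ; α≡ = refl ; length-doneLetters = refl
        ; items≡ = trans items-P (sym length-α) ; rest-free = α-fixed-point-free }

      after-fixed : ∀ {i c p as} → Progress i c (true ∷ p) as → Progress (suc i) c p as
      after-fixed pr = record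
        { donePlaces = donePlaces pr ; places≡ = places≡ pr ; length-donePlaces = length-donePlaces pr
        ; donePlaces<i = All.map ℕ.m≤n⇒m≤1+n (donePlaces<i pr)
        ; doneLetters = doneLetters pr ; α≡ = α≡ pr ; length-doneLetters = length-doneLetters pr
        ; items≡ = items≡ pr ; rest-free = rest-free pr }

      after-item : ∀ {i c p x as} → Progress i c (false ∷ p) (x ∷ as) → Progress (suc i) (suc c) p as
      after-item {i} {c} {p} {x} {as} pr = record
        { donePlaces         = donePlaces pr ++ i ∷ []
        ; places≡            = trans (places≡ pr) (sym (List.++-assoc (donePlaces pr) (i ∷ []) _))
        ; length-donePlaces  = trans (Pattern.length-∷ʳ (donePlaces pr) i) (cong suc (length-donePlaces pr))
        ; donePlaces<i       = All.++⁺ (All.map ℕ.m≤n⇒m≤1+n (donePlaces<i pr)) (ℕ.≤-refl ∷ [])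
        ; doneLetters        = doneLetters pr ++ x ∷ []
        ; α≡                 = trans (α≡ pr) (sym (List.++-assoc (doneLetters pr) (x ∷ []) as))
        ; length-doneLetters = trans (Pattern.length-∷ʳ (doneLetters pr) x) (cong suc (length-doneLetters pr))
        ; items≡             = ℕ.suc-injective (items≡ pr)
        ; rest-free          = proj₂ (rest-free pr)
        }

      next-letter : ∀ {i c p x as} → Progress i c p (x ∷ as) → letterAt α (suc c) ≡ x
      next-letter pr = trans (cong (λ w → letterAt w _) (α≡ pr)) (letterAt-++ (doneLetters pr) (length-doneLetters pr))

      next-in-range : ∀ {i c p x as} → Progress i c p (x ∷ as) → InRangeα (proj₁ x)
      next-in-range pr = All.lookup α-in-range (subst (_ ∈_) (sym (α≡ pr)) (∈-++⁺ʳ (doneLetters pr) (here refl)))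

      next≤k : ∀ {i c p x as} → Progress i c p (x ∷ as) → suc c ≤ k
      next≤k {c = c} {as = as} pr = subst (suc c ≤_) (trans (sym length≡) length-α) (ℕ.m≤m+n (suc c) (length as))
        where
        length≡ : length α ≡ suc c +ℕ length as
        length≡ = trans (cong length (α≡ pr))
                        (trans (List.length-++ (doneLetters pr))
                               (trans (cong (_+ℕ suc (length as)) (length-doneLetters pr)) (ℕ.+-suc c (length as))))

      place-next : ∀ {i c p as} → Progress i c (false ∷ p) as → place (suc c) ≡ i
      place-next pr = trans (cong (λ ps → nth ps _) (places≡ pr)) (nth-++ (donePlaces pr) (length-donePlaces pr))

      fixed∉places : ∀ {i c p as} → Progress i c (true ∷ p) as → i ∉ places
      fixed∉places {i} {p = p} pr i∈ with ∈-++⁻ (donePlaces pr) (subst (i ∈_) (places≡ pr) i∈)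
      ... | inj₁ i∈done = ℕ.<-irrefl refl (All.lookup (donePlaces<i pr) i∈done)
      ... | inj₂ i∈rest = ℕ.<-irrefl refl (All.lookup (itemPositions-≥ (suc i) p) i∈rest)

      -- A fixed point at i followed by the letter of index c + 1 at i + 1: the other letters a of α lie
      -- below i exactly when a < c + 1.
      place-vs-fixed-before : ∀ {i c a} → place (suc c) ≡ suc i → i ∉ places → suc c ≤ k → InRangeα a → a ≢ suc c →
                              (place a <ᵇ i) ≡ not (suc c <ᵇ a)
      place-vs-fixed-before {i} {c} {a} e i∉ sc≤k a∈@(1≤a , a≤k) a≢ with ℕ.<-cmp a (suc c)
      ... | tri< a<sc _ _ = trans (<ᵇ-true place<i) (cong not (sym (<ᵇ-false (ℕ.<⇒≤ a<sc))))
        where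
        place<i : place a < i
        place<i with ℕ.m≤n⇒m<n∨m≡n (ℕ.≤-pred (subst (place a <_) e (place-monotone 1≤a a<sc sc≤k)))
        ... | inj₁ lt   = lt
        ... | inj₂ e′   = ⊥-elim (i∉ (subst (_∈ places) e′ (place-∈ a∈)))
      ... | tri≈ _ a≡sc _ = ⊥-elim (a≢ a≡sc)
      ... | tri> _ _ sc<a =
        trans (<ᵇ-false (ℕ.≤-trans (ℕ.n≤1+n i) (ℕ.<⇒≤ (subst (_< place a) e (place-monotone (s≤s z≤n) sc<a a≤k)))))
              (cong not (sym (<ᵇ-true sc<a)))

      -- The letter of index c + 1 at i followed by a fixed point at i + 1.
      place-vs-fixed-after : ∀ {i c a} → place (suc c) ≡ i → suc i ∉ places → suc c ≤ k → InRangeα a →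
                             (suc i <ᵇ place a) ≡ (suc c <ᵇ a)
      place-vs-fixed-after {i} {c} {a} e si∉ sc≤k a∈@(1≤a , a≤k) with ℕ.<-cmp a (suc c)
      ... | tri< a<sc _ _ =
        trans (<ᵇ-false (ℕ.<⇒≤ (ℕ.<-trans (subst (place a <_) e (place-monotone 1≤a a<sc sc≤k)) (ℕ.n<1+n i))))
              (sym (<ᵇ-false (ℕ.<⇒≤ a<sc)))
      ... | tri≈ _ refl _ = trans (<ᵇ-false (ℕ.≤-trans (ℕ.≤-reflexive e) (ℕ.n≤1+n i))) (sym (<ᵇ-false (ℕ.≤-refl {suc c})))
      ... | tri> _ _ sc<a = trans (<ᵇ-true si<place) (sym (<ᵇ-true sc<a))
        where
        si<place : suc i < place a
        si<place with ℕ.m≤n⇒m<n∨m≡n (subst (_< place a) e (place-monotone (s≤s z≤n) sc<a a≤k))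
        ... | inj₁ lt   = lt
        ... | inj₂ e′   = ⊥-elim (si∉ (subst (_∈ places) (sym e′) (place-∈ a∈)))

      high-next : ∀ {i c p x as} → Progress i c p (x ∷ as) → high (suc c) ≡ Above (suc c) x
      high-next pr = cong (Above _) (next-letter pr)

      descent-fixed-item : ∀ {i c p x as} → Progress i c (true ∷ false ∷ p) (x ∷ as) →
                           (relabel x <ᶜ (i , Fin.zero)) ≡ not (high (suc c))
      descent-fixed-item {x = a , Fin.suc _} pr rewrite high-next pr = refl
      descent-fixed-item {x = a , Fin.zero}  pr rewrite high-next pr =
        place-vs-fixed-before (place-next (after-fixed pr)) (fixed∉places pr) (next≤k pr) (next-in-range pr)
                              (λ e → proj₁ (rest-free pr) (cong (_, Fin.zero) e))

      descent-item-fixed : ∀ {i c p x as} → Progress i c (false ∷ true ∷ p) (x ∷ as) →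
                           ((suc i , Fin.zero) <ᶜ relabel x) ≡ high (suc c)
      descent-item-fixed {x = a , Fin.suc _} pr rewrite high-next pr = refl
      descent-item-fixed {x = a , Fin.zero}  pr rewrite high-next pr =
        place-vs-fixed-after (place-next pr) (fixed∉places (after-item pr)) (next≤k pr) (next-in-range pr)

      descent-item-item : ∀ {i c p x x′ as} → Progress i c (false ∷ false ∷ p) (x ∷ x′ ∷ as) →
                          (relabel x′ <ᶜ relabel x) ≡ itemDescent (suc c) (suc (suc c))
      descent-item-item {x = a , col} {x′ = a′ , col′} pr =
        trans (cong (λ b → (toℕ col <ᵇ toℕ col′) ∨ ((toℕ col′ ≡ᵇ toℕ col) ∧ b))
                    (place-<ᵇ (next-in-range pr) (next-in-range (after-item pr))))
              (sym (cong₂ _<ᶜ_ (next-letter (after-item pr)) (next-letter pr)))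

      majFrom-fillFrom : ∀ {i c p as} → Progress i c p as → majFrom i (fillFrom i p as) ≡ majWith descent i (entries c p)
      majFrom-fillFrom {p = []}                                pr = refl
      majFrom-fillFrom {p = true ∷ []}                         pr = refl
      majFrom-fillFrom {p = false ∷ []} {[]}                   pr = refl
      majFrom-fillFrom {p = false ∷ []} {x ∷ as}               pr = refl
      majFrom-fillFrom {i} {p = true ∷ true ∷ p}               pr =
        cong₂ _+ℕ_ (cong (λ b → when b i) (<ᵇ-false (ℕ.n≤1+n i))) (majFrom-fillFrom (after-fixed pr))
      majFrom-fillFrom {i} {p = true ∷ false ∷ p} {x ∷ as}     pr =
        cong₂ _+ℕ_ (cong (λ b → when b i) (descent-fixed-item pr)) (majFrom-fillFrom (after-fixed pr))
      majFrom-fillFrom {i} {p = false ∷ true ∷ p} {x ∷ as}     pr =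
        cong₂ _+ℕ_ (cong (λ b → when b i) (descent-item-fixed pr)) (majFrom-fillFrom (after-item pr))
      majFrom-fillFrom {i} {p = false ∷ false ∷ p} {x ∷ x′ ∷ as} pr =
        cong₂ _+ℕ_ (cong (λ b → when b i) (descent-item-item pr)) (majFrom-fillFrom (after-item pr))
      majFrom-fillFrom {p = true ∷ false ∷ p} {[]}             pr with () ← items≡ pr
      majFrom-fillFrom {p = false ∷ _ ∷ p} {[]}                pr with () ← items≡ pr
      majFrom-fillFrom {p = false ∷ false ∷ p} {x ∷ []}        pr with () ← items≡ pr

      relabel-not-fixed : ∀ {i c p x as} → Progress i c (false ∷ p) (x ∷ as) → relabel x ≢ (i , Fin.zero)
      relabel-not-fixed {x = a , col} pr e =
        proj₁ (rest-free pr) (cong₂ _,_ (place-injective (next-in-range pr) (s≤s z≤n , next≤k pr)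
                                                         (trans (cong proj₁ e) (sym (place-next pr))))
                                        (cong proj₂ e))

      delFixed-fillFrom : ∀ {i c p as} → Progress i c p as → delFixed i (fillFrom i p as) ≡ map relabel as
      delFixed-fillFrom {p = []} {[]}                 pr = refl
      delFixed-fillFrom {i} {p = true ∷ p}            pr with (i , Fin.zero) ≟ᶜ (i , Fin.zero)
      ... | yes _   = delFixed-fillFrom (after-fixed pr)
      ... | no  i≢i = ⊥-elim (i≢i refl)
      delFixed-fillFrom {i} {p = false ∷ p} {x ∷ as}  pr with relabel x ≟ᶜ (i , Fin.zero)
      ... | yes e = ⊥-elim (relabel-not-fixed pr e)
      ... | no  _ = cong (relabel x ∷_) (delFixed-fillFrom (after-item pr))
      delFixed-fillFrom {p = []} {x ∷ as}             pr with () ← items≡ pr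
      delFixed-fillFrom {p = false ∷ p} {[]}          pr with () ← items≡ pr

      fixedPattern-fillFrom : ∀ {i c p as} → Progress i c p as → fixedPattern i (fillFrom i p as) ≡ p
      fixedPattern-fillFrom {p = []}                      pr = refl
      fixedPattern-fillFrom {i} {p = true ∷ p}            pr with (i , Fin.zero) ≟ᶜ (i , Fin.zero)
      ... | yes _   = cong (true ∷_) (fixedPattern-fillFrom (after-fixed pr))
      ... | no  i≢i = ⊥-elim (i≢i refl)
      fixedPattern-fillFrom {i} {p = false ∷ p} {x ∷ as}  pr with relabel x ≟ᶜ (i , Fin.zero)
      ... | yes e = ⊥-elim (relabel-not-fixed pr e)
      ... | no  _ = cong (false ∷_) (fixedPattern-fillFrom (after-item pr))
      fixedPattern-fillFrom {p = false ∷ p} {[]}          pr with () ← items≡ pr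

      length-fillFrom : ∀ {i p as} → items p ≡ length as → length (fillFrom i p as) ≡ length p
      length-fillFrom {p = []}                 _ = refl
      length-fillFrom {p = true ∷ p}           e = cong suc (length-fillFrom {p = p} e)
      length-fillFrom {p = false ∷ p} {x ∷ as} e = cong suc (length-fillFrom {p = p} (ℕ.suc-injective e))

      values-fillFrom : ∀ {i p as} → items p ≡ length as →
                        map proj₁ (fillFrom i p as) ↭ fixedPositions i p ++ map (place ∘ proj₁) as
      values-fillFrom {p = []} {[]}                  _ = ↭-refl
      values-fillFrom {i} {p = true ∷ p}             e = ↭-prep i (values-fillFrom {p = p} e)
      values-fillFrom {i} {p = false ∷ p} {x ∷ as}   e =
        ↭-trans (↭-prep (place (proj₁ x)) (values-fillFrom {p = p} (ℕ.suc-injective e)))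
                (↭-sym (↭.shift (place (proj₁ x)) (fixedPositions (suc i) p) _))

      fillFrom-in-range : ∀ {n i p as} → length P ≡ n → 1 ≤ i → i +ℕ length p ≡ suc n → All InRangeα (map proj₁ as) →
                          All (InRange n) (fillFrom i p as)
      fillFrom-in-range {p = []}                 _   _   _ _ = []
      fillFrom-in-range {i = i} {p = true ∷ p}   len 1≤i e as-in =
        (1≤i , ℕ.≤-pred (subst (i <_) e (ℕ.m<m+n i (s≤s z≤n))))
        ∷ fillFrom-in-range len (ℕ.m≤n⇒m≤1+n 1≤i) (trans (sym (ℕ.+-suc i (length p))) e) as-in
      fillFrom-in-range {p = false ∷ p} {[]}     _   _   _ _ = []
      fillFrom-in-range {i = i} {p = false ∷ p} {x ∷ as} len 1≤i e (x-in ∷ as-in) =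
        (proj₁ bounds , ℕ.≤-pred (subst (place (proj₁ x) <_) (cong suc len) (proj₂ bounds)))
        ∷ fillFrom-in-range len (ℕ.m≤n⇒m≤1+n 1≤i) (trans (sym (ℕ.+-suc i (length p))) e) as-in
        where
        bounds = positions-bounded 1 P (inj₂ (place-∈ x-in))

      N-relabel-fillFrom : ∀ j {i p as} → items p ≡ length as → N (suc j) (fillFrom i p as) ≡ N (suc j) as
      N-relabel-fillFrom j {p = []} {[]}                _ = refl
      N-relabel-fillFrom j {i} {p = true ∷ p}           e = N-relabel-fillFrom j {suc i} {p} e
      N-relabel-fillFrom j {i} {p = false ∷ p} {(a , col) ∷ as} e =
        N-∷-cong (suc j) (place a , col) (a , col) refl (N-relabel-fillFrom j {suc i} {p} (ℕ.suc-injective e))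

      count≤-place : ∀ {a} → InRangeα a → ∀ vs → All InRangeα vs → count≤ (place a) (map place vs) ≡ count≤ a vs
      count≤-place a-in []       []              = refl
      count≤-place {a} a-in (v ∷ vs) (v-in ∷ vs-in) with v ℕ.≤? a
      ... | yes v≤a = trans (cong length (List.filter-accept (_≤? place a) {x = place v} {xs = map place vs}
                                           (nth-mono-≤ places-increasing (proj₁ v-in) v≤a (≤k⇒≤length (proj₂ a-in)))))
                            (trans (cong suc (count≤-place a-in vs vs-in))
                                   (sym (cong length (List.filter-accept (_≤? a) {x = v} {xs = vs} v≤a))))
      ... | no  v≰a = trans (cong length (List.filter-reject (_≤? place a) {x = place v} {xs = map place vs}
                                           (λ le → v≰a (nth-cancel-≤ places-increasing (proj₁ v-in) (≤k⇒≤length (proj₂ v-in))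
                                                                      (proj₁ a-in) (≤k⇒≤length (proj₂ a-in)) le))))
                            (trans (count≤-place a-in vs vs-in)
                                   (sym (cong length (List.filter-reject (_≤? a) {x = v} {xs = vs} v≰a))))

      values-α-in-range : All InRangeα (map proj₁ α)
      values-α-in-range = All.map⁺ α-in-range

      count≤-values-α : ∀ {a} → a ≤ k → count≤ a (map proj₁ α) ≡ a
      count≤-values-α a≤k =
        trans (count≤-↭ _ (↭-range α-unique values-α-in-range (trans (List.length-map proj₁ α) length-α)))
              (count≤-range a≤k)

      -- Reduction undoes the relabelling, since place is increasing on the values 1 … k of α.
      reduce-relabel : reduce (map relabel α) ≡ α
      reduce-relabel = trans (sym (List.map-∘ α)) (trans (List.map-cong-local (All.map reduced α-in-range)) (List.map-id α))
        where
        reduced : ∀ {x} → InRange k x → (count≤ (place (proj₁ x)) (map proj₁ (map relabel α)) , proj₂ x) ≡ x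
        reduced {x} x-in = cong (_, proj₂ x)
          (trans (cong (count≤ (place (proj₁ x))) (trans (sym (List.map-∘ α)) (List.map-∘ α)))
                 (trans (count≤-place x-in (map proj₁ α) values-α-in-range) (count≤-values-α (proj₂ x-in))))

      dp-fill : dp fill ≡ α
      dp-fill = trans (cong reduce (delFixed-fillFrom start)) reduce-relabel

      fixedPattern-fill : fixedPattern 1 fill ≡ P
      fixedPattern-fill = fixedPattern-fillFrom start

      fmaj₃-fill : fmaj₃ fill ≡ 3 * patternMaj P +ℕ N 1 α +ℕ 2 * N 2 α
      fmaj₃-fill = cong₃ (λ m n₁ n₂ → 3 * m +ℕ n₁ +ℕ 2 * n₂)
                         (majFrom-fillFrom start)
                         (N-relabel-fillFrom 0 {1} {P} (items≡ start)) (N-relabel-fillFrom 1 {1} {P} (items≡ start))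

      fill-perm : ∀ {n} → length P ≡ n → IsColPerm n fill
      fill-perm {n} len =
        trans (length-fillFrom {1} {P} (items≡ start)) len ,
        fillFrom-in-range len (s≤s z≤n) (cong suc len) values-α-in-range ,
        Unique-resp-↭ (↭-sym (values-fillFrom {1} {P} (items≡ start))) values-unique
        where
        placed-unique : Unique (map place (map proj₁ α))
        placed-unique = Unique-map-injectiveOn place α-unique
          (λ a∈ b∈ → place-injective (All.lookup values-α-in-range a∈) (All.lookup values-α-in-range b∈))
        values-unique : Unique (fixedPositions 1 P ++ map (place ∘ proj₁) α)
        values-unique =
          Unique.++⁺ (Increasing⇒Unique (fixedPositions-increasing 1 P)) (subst Unique (sym (List.map-∘ α)) placed-unique)
            (λ (z∈fixed , z∈placed) → positions-disjoint 1 P z∈fixed (placed⊆places (subst (_ ∈_) (List.map-∘ α) z∈placed)))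
          where
          placed⊆places : ∀ {z} → z ∈ map place (map proj₁ α) → z ∈ places
          placed⊆places z∈ with ∈-map⁻ place z∈
          ... | v , v∈ , refl = place-∈ (All.lookup values-α-in-range v∈)

  -- Every σ with dp σ = α is the filling of its own fixed-point pattern.
  module Inverse {n σ} (σ-perm : IsColPerm n σ) (dp≡α : dp σ ≡ α) where

    open Pattern using (items; Shape; items≤length)
    open Positions

    σ-pattern : List Bool
    σ-pattern = fixedPattern 1 σ

    letters : Word
    letters = delFixed 1 σ

    values : List ℕ
    values = map proj₁ letters

    items-pattern : items σ-pattern ≡ k
    items-pattern = trans (items-fixedPattern 1 σ)
                          (trans (sym (List.length-map _ letters)) (trans (cong length dp≡α) length-α))

    length-pattern : length σ-pattern ≡ n
    length-pattern = trans (length-fixedPattern 1 σ) (proj₁ σ-perm)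

    pattern-shape : Shape k (n ∸ k) σ-pattern
    pattern-shape = items-pattern , trans length-pattern (sym (ℕ.m+[n∸m]≡n k≤n))
      where
      k≤n : k ≤ n
      k≤n = subst₂ _≤_ items-pattern length-pattern (items≤length σ-pattern)

    open Filling σ-pattern

    σ-values-unique : Unique (fixedPositions 1 σ-pattern ++ values)
    σ-values-unique = Unique-resp-↭ (values-↭ 1 σ) (proj₂ (proj₂ σ-perm))

    σ-values-in-range : All (InRangeℕ n) (map proj₁ σ)
    σ-values-in-range = All.map⁺ (proj₁ (proj₂ σ-perm))

    values⊆places : ∀ {z} → z ∈ values → z ∈ places
    values⊆places {z} z∈ with positions-cover 1 σ-pattern (proj₁ bounds , subst (z <_) (cong suc (sym length-pattern)) (s≤s (proj₂ bounds)))
      where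
      bounds = All.lookup σ-values-in-range (↭.Any-resp-↭ (↭-sym (values-↭ 1 σ)) (∈-++⁺ʳ (fixedPositions 1 σ-pattern) z∈))
    ... | inj₁ z∈fixed = ⊥-elim (Unique-++-disjoint (fixedPositions 1 σ-pattern) σ-values-unique z∈fixed z∈)
    ... | inj₂ z∈items = z∈items

    places⊆values : ∀ {z} → z ∈ places → z ∈ values
    places⊆values {z} z∈ with ∈-++⁻ (fixedPositions 1 σ-pattern) (↭.Any-resp-↭ (values-↭ 1 σ) z∈σ)
      where
      bounds = positions-bounded 1 σ-pattern (inj₂ z∈)
      z∈σ : z ∈ map proj₁ σ
      z∈σ = Unique-in-range-complete (proj₂ (proj₂ σ-perm)) σ-values-in-range (trans (List.length-map proj₁ σ) (proj₁ σ-perm))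
              (proj₁ bounds , ℕ.≤-pred (subst (z <_) (cong suc length-pattern) (proj₂ bounds)))
    ... | inj₁ z∈fixed = ⊥-elim (positions-disjoint 1 σ-pattern z∈fixed z∈)
    ... | inj₂ z∈values = z∈values

    values↭places : values ↭ places
    values↭places = same-members⇒↭ (Unique-++⁻ʳ (fixedPositions 1 σ-pattern) σ-values-unique)
                                   (Increasing⇒Unique (places-increasing items-pattern)) values⊆places places⊆values

    place-rank : ∀ {x} → x ∈ letters → place (count≤ (proj₁ x) values) ≡ proj₁ x
    place-rank {x} x∈ = trans (cong place (count≤-↭ (proj₁ x) values↭places))
                              (nth-count≤ (places-increasing items-pattern) (values⊆places (∈-map⁺ proj₁ x∈)))

    rank : CLetter → CLetter
    rank x = (count≤ (proj₁ x) values , proj₂ x)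

    refill : ∀ i r → (∀ {x} → x ∈ delFixed i r → place (count≤ (proj₁ x) values) ≡ proj₁ x) →
             fillFrom i (fixedPattern i r) (map rank (delFixed i r)) ≡ r
    refill i []      _      = refl
    refill i (x ∷ r) placed with x ≟ᶜ (i , Fin.zero)
    ... | yes refl = cong ((i , Fin.zero) ∷_) (refill (suc i) r placed)
    ... | no  _    = cong₂ _∷_ (cong (_, proj₂ x) (placed (here refl))) (refill (suc i) r (placed ∘ there))

    σ≡fill : σ ≡ fill
    σ≡fill = trans (sym (refill 1 σ place-rank)) (cong (fillFrom 1 σ-pattern) dp≡α)

  fmaj₃-α : fmaj₃ α ≡ 3 * itemsMaj k +ℕ N 1 α +ℕ 2 * N 2 α
  fmaj₃-α = subst (λ w → fmaj₃ w ≡ 3 * itemsMaj k +ℕ N 1 α +ℕ 2 * N 2 α) fill≡α (fmaj₃-fill (Pattern.items-replicate k))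
    where
    open Filling (replicate k false)
    place-id : ∀ {a} → InRangeα a → place a ≡ a
    place-id {suc a} (_ , a<k) = shifted 1 k a a<k
      where
      shifted : ∀ i m a → a < m → Positions.nth (Positions.itemPositions i (replicate m false)) (suc a) ≡ i +ℕ a
      shifted i (suc m) zero    _         = sym (ℕ.+-identityʳ i)
      shifted i (suc m) (suc a) (s≤s a<m) = trans (shifted (suc i) m a a<m) (sym (ℕ.+-suc i a))
    fillFrom-items : ∀ i m as → length as ≡ m → fillFrom i (replicate m false) as ≡ map relabel as
    fillFrom-items i zero    []       _   = refl
    fillFrom-items i (suc m) (x ∷ as) len = cong (relabel x ∷_) (fillFrom-items (suc i) m as (ℕ.suc-injective len))
    fill≡α : fill ≡ α
    fill≡α = trans (fillFrom-items 1 k α length-α)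
                   (List.map-id-local (All.map (λ {x} x-in → cong (_, proj₂ x) (place-id x-in)) α-in-range))

module Fibre (n k : ℕ) (k≤n : k ≤ n) (α : Word) (hα : IsDerangement k α) where

  open import Data.Nat using (_*_) renaming (_+_ to _+ℕ_)
  import Data.Nat.Properties as ℕ
  open import Data.Nat.Tactic.RingSolver using (solve-∀)
  open import Data.List using (List; map; filter)
  import Data.List.Properties as List
  open import Data.List.Relation.Unary.All as All using ()
  open import Data.List.Membership.Propositional using (_∈_)
  open import Data.List.Membership.Propositional.Properties using (∈-map⁺; ∈-map⁻; ∈-filter⁺; ∈-filter⁻)
  import Data.List.Relation.Unary.Unique.Propositional.Properties as Unique
  open import Data.List.Relation.Binary.Permutation.Propositional using (_↭_; module PermutationReasoning)
  import Data.List.Relation.Binary.Permutation.Propositional.Properties as ↭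
  open import Data.Product using (_,_; proj₁; proj₂)
  open import Function using (_∘_)
  open import Relation.Binary.PropositionalEquality
  open Derangement α k hα
  open Pattern using (patterns; patterns-unique; patterns-shape; patterns-complete)
  open GaussianBinomial using (binomExps; shift)
  open ListFacts using (same-members⇒↭; Unique-map-injectiveOn)
  open ColouredPermutations using (∈-S³⁺; ∈-S³⁻; S³-unique)
  open FixedPointPattern using (fixedPattern)

  M : ℕ
  M = n ∸ k

  fibre : List Word
  fibre = filter (λ σ → dp σ ≟ʷ α) (S³ n)

  fill : List Bool → Word
  fill P = Filling.fill P

  fibre↭fills : fibre ↭ map fill (patterns k M)
  fibre↭fills = same-members⇒↭ (Unique.filter⁺ (λ σ → dp σ ≟ʷ α) (S³-unique n))
                               (Unique-map-injectiveOn fill (patterns-unique k M) fill-injective) fibre⊆ ⊆fibre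
    where
    items≡k : ∀ {P} → P ∈ patterns k M → Pattern.items P ≡ k
    items≡k P∈ = proj₁ (All.lookup (patterns-shape k M) P∈)
    fill-injective : ∀ {P Q} → P ∈ patterns k M → Q ∈ patterns k M → fill P ≡ fill Q → P ≡ Q
    fill-injective {P} {Q} P∈ Q∈ e = trans (sym (Filling.fixedPattern-fill P (items≡k P∈)))
                                           (trans (cong (fixedPattern 1) e) (Filling.fixedPattern-fill Q (items≡k Q∈)))
    fibre⊆ : ∀ {σ} → σ ∈ fibre → σ ∈ map fill (patterns k M)
    fibre⊆ σ∈ with ∈-filter⁻ (λ σ → dp σ ≟ʷ α) {xs = S³ n} σ∈
    ... | σ∈S³ , dp≡α = subst (_∈ map fill (patterns k M)) (sym (Inverse.σ≡fill {n} (∈-S³⁻ σ∈S³) dp≡α))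
                              (∈-map⁺ fill (patterns-complete _ (Inverse.pattern-shape {n} (∈-S³⁻ σ∈S³) dp≡α)))
    ⊆fibre : ∀ {σ} → σ ∈ map fill (patterns k M) → σ ∈ fibre
    ⊆fibre σ∈ with ∈-map⁻ fill σ∈
    ... | P , P∈ , refl =
      ∈-filter⁺ (λ σ → dp σ ≟ʷ α)
        (∈-S³⁺ (Filling.fill-perm P (items≡k P∈) (trans (proj₂ (All.lookup (patterns-shape k M) P∈)) (ℕ.m+[n∸m]≡n k≤n))))
        (Filling.dp-fill P (items≡k P∈))

  fmaj₃-fibre : map fmaj₃ fibre ↭ shift (fmaj₃ α) (map (3 *_) (binomExps n k))
  fmaj₃-fibre = begin
    map fmaj₃ fibre
      ↭⟨ ↭.map⁺ fmaj₃ fibre↭fills ⟩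
    map fmaj₃ (map fill (patterns k M))
      ≡⟨ trans (sym (List.map-∘ (patterns k M)))
               (trans (List.map-cong-local (All.tabulate (λ {P} P∈ → Filling.fmaj₃-fill P (proj₁ (All.lookup (patterns-shape k M) P∈)))))
                      (List.map-∘ (patterns k M))) ⟩
    map stat (majs (patterns k M))
      ↭⟨ ↭.map⁺ stat (majs-patterns k M) ⟩
    map stat (shift (itemsMaj k) (binomExps (k +ℕ M) k))
      ≡⟨ trans (sym (List.map-∘ (binomExps (k +ℕ M) k)))
               (trans (cong (λ m → map (stat ∘ (itemsMaj k +ℕ_)) (binomExps m k)) (ℕ.m+[n∸m]≡n k≤n))
                      (trans (List.map-cong shifted (binomExps n k)) (List.map-∘ (binomExps n k)))) ⟩
    shift (fmaj₃ α) (map (3 *_) (binomExps n k))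
      ∎
    where
    open PermutationReasoning
    stat : ℕ → ℕ
    stat m = 3 * m +ℕ N 1 α +ℕ 2 * N 2 α
    shifted : ∀ e → stat (itemsMaj k +ℕ e) ≡ fmaj₃ α +ℕ 3 * e
    shifted e = trans (regroup (itemsMaj k) e (N 1 α) (N 2 α)) (cong (_+ℕ 3 * e) (sym fmaj₃-α))
      where
      regroup : ∀ a b c d → 3 * (a +ℕ b) +ℕ c +ℕ 2 * d ≡ 3 * a +ℕ c +ℕ 2 * d +ℕ 3 * b
      regroup = solve-∀

  open Polynomial
  open GaussianBinomial using (gaussian)

  LHS≈ : LHS n α ≈ mono (fmaj₃ α) · gaussian 3 n k
  LHS≈ = ≈-trans (genFun≈gen fibre fmaj₃) (≈-trans (gen-↭ fmaj₃-fibre) (gen-map-+ (fmaj₃ α) (map (3 *_) (binomExps n k))))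

open Polynomial
open GaussianBinomial using (gaussian; qfac; qfact₃≈qfac; qfac-·-qfac-·-gaussian)
open import Algebra.Bundles using (CommutativeMonoid)
open import Algebra.Properties.CommutativeSemigroup (CommutativeMonoid.commutativeSemigroup ·-commutativeMonoid)
  using (x∙yz≈y∙xz)

theorem3p1 : (n k : ℕ) → k ≤ n → (α : Word) → IsDerangement k α →
    (m : ℕ) →
    ((qfact₃ k *P qfact₃ (n ∸ k)) *P LHS n α) m ≡ (mono (fmaj₃ α) *P qfact₃ n) m
theorem3p1 n k k≤n α hα = begin
  (qfact₃ k *P qfact₃ (n ∸ k)) *P LHS n α
    ≈⟨ ≈-trans (*P≈· _ _) (·-cong (≈-trans (*P≈· _ _) (·-cong (qfact₃≈qfac k) (qfact₃≈qfac (n ∸ k))))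
                                  (Fibre.LHS≈ n k k≤n α hα)) ⟩
  qfac 3 k · qfac 3 (n ∸ k) · (mono (fmaj₃ α) · gaussian 3 n k)
    ≈⟨ x∙yz≈y∙xz (qfac 3 k · qfac 3 (n ∸ k)) (mono (fmaj₃ α)) (gaussian 3 n k) ⟩
  mono (fmaj₃ α) · (qfac 3 k · qfac 3 (n ∸ k) · gaussian 3 n k)
    ≈⟨ ·-cong ≈-refl (qfac-·-qfac-·-gaussian 3 k≤n) ⟩
  mono (fmaj₃ α) · qfac 3 n
    ≈⟨ ≈-sym (≈-trans (*P≈· _ _) (·-cong ≈-refl (qfact₃≈qfac n))) ⟩
  mono (fmaj₃ α) *P qfact₃ n
    ∎
  where open ≈-Reasoning
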